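{- For a positive integer $n$ and $1\le k\le n+1$, say that $k$ is reconstructing (resp. directed-reconstructing) for $n$ if any two permutations of $[n]\cup\{0,n+1\}$ having the same $k$-profile (resp. the same directed $k$-profile) are equal, i.e. every $k$-profile (resp. directed $k$-profile) is the $k$-profile of at most one permutation. Let $k_u(n)$ (resp. $k_d(n)$) be the minimum reconstructing (resp. directed-reconstructing) $k$. Then: (a) $k_u(n)=\max\{1,n-3\}$; (b) $k_d(n)\ge \lceil (n-3)/2\rceil$ for $n\ge 4$, and $k_d(n)=1$ for $n=1,2,3$.
   Context: $[n]=\{1,\dots,n\}$. Permutations are of $[n]\cup\{0,n+1\}$, always with $0$ at the leftmost position and $n+1$ at the rightmost position. For a permutation $P$ and elements $t<t+i$, let $\min_{t,t+i}$ and $\max_{t,t+i}$ be the minimum and maximum of the elements located on $P$ in the interval delimited by the element $t$ (included) and the element $t+i$ (included). The $k$-profile of $P$ ($1\le k\le n+1$) is the set of constraints $\{(t,t+i,[\min_{t,t+i},\max_{t,t+i}]) : 1\le i\le k,\ 0\le t\le n+1-i\}$ (no information on which of $t$, $t+i$ is to the left). The directed $k$-profile of $P$ consists of the same constraints together with, for each such pair, the information whether $t$ is to the left or to the right of $t+i$ in $P$. -}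

module Defs where

open import Data.Bool.Base using (if_then_else_)
open import Data.Fin.Base using (Fin; zero; fromℕ; toℕ; _≤_)
open import Data.Fin.Permutation using (Permutation′; _⟨$⟩ʳ_; _⟨$⟩ˡ_; _≈_)
open import Data.Fin.Properties using (_≤?_; _<?_; ≤-totalOrder)
open import Data.List.Base using (List; filter; allFin)
import Data.List.Extrema as Extrema
open import Data.Nat.Base as ℕ using (ℕ; suc; _+_)
open import Data.Product.Base using (∃-syntax; _×_; _,_)
open import Data.Sum.Base using (_⊎_)
open import Relation.Binary.PropositionalEquality.Core using (_≡_)
open import Relation.Nullary.Decidable using (does; _×-dec_; _⊎-dec_)
open import Relation.Unary using (Pred; Decidable; _≐_)
open import Level using (0ℓ)

-- A permutation of [n] ∪ {0, n+1}: `perm` sends a position to the element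
-- located there, both being numbered 0, …, n+1.
record FramedPermutation (n : ℕ) : Set where
  field
    perm      : Permutation′ (2 + n)
    leftmost  : perm ⟨$⟩ʳ zero ≡ zero
    rightmost : perm ⟨$⟩ʳ fromℕ (suc n) ≡ fromℕ (suc n)

  elementAt : Fin (2 + n) → Fin (2 + n)
  elementAt p = perm ⟨$⟩ʳ p

  position : Fin (2 + n) → Fin (2 + n)
  position x = perm ⟨$⟩ˡ x

open FramedPermutation public

module _ {n : ℕ} (P : FramedPermutation n) where

  -- Either of t and u may be the left end of the interval.
  Between : (t u x : Fin (2 + n)) → Set
  Between t u x =
    (position P t ≤ position P x × position P x ≤ position P u) ⊎
    (position P u ≤ position P x × position P x ≤ position P t)

  between? : (t u : Fin (2 + n)) → Decidable (Between t u)
  between? t u x =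
    ((position P t ≤? position P x) ×-dec (position P x ≤? position P u)) ⊎-dec
    ((position P u ≤? position P x) ×-dec (position P x ≤? position P t))

  interval : (t u : Fin (2 + n)) → List (Fin (2 + n))
  interval t u = filter (between? t u) (allFin (2 + n))

  -- The library's min and max take a default value; t is a harmless one,
  -- since it belongs to the interval.
  minBetween : (t u : Fin (2 + n)) → Fin (2 + n)
  minBetween t u = Extrema.min (≤-totalOrder (2 + n)) t (interval t u)

  maxBetween : (t u : Fin (2 + n)) → Fin (2 + n)
  maxBetween t u = Extrema.max (≤-totalOrder (2 + n)) t (interval t u)

data Side : Set where
  left right : Side

-- The side of u on which t is located.
side : ∀ {n} → FramedPermutation n → (t u : Fin (2 + n)) → Side
side P t u = if does (position P t <? position P u) then left else right

-- The triple (t, u, [lo, hi]).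
record Constraint (n : ℕ) : Set where
  constructor ⟨_,_,[_,_]⟩
  field
    t u lo hi : Fin (2 + n)

-- The bound t ≤ n + 1 - i is implied by u = t + i being an element.
Profile : ∀ {n} → ℕ → FramedPermutation n → Pred (Constraint n) 0ℓ
Profile k P ⟨ t , u ,[ lo , hi ]⟩ =
  ∃[ i ] 1 ℕ.≤ i × i ℕ.≤ k × toℕ u ≡ toℕ t + i ×
         lo ≡ minBetween P t u × hi ≡ maxBetween P t u

DirectedProfile : ∀ {n} → ℕ → FramedPermutation n → Pred (Constraint n × Side) 0ℓ
DirectedProfile k P (c , s) =
  Profile k P c × s ≡ side P (Constraint.t c) (Constraint.u c)

Reconstructing : ℕ → ℕ → Set
Reconstructing n k = (P Q : FramedPermutation n) →
  Profile k P ≐ Profile k Q → perm P ≈ perm Q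

DirectedReconstructing : ℕ → ℕ → Set
DirectedReconstructing n k = (P Q : FramedPermutation n) →
  DirectedProfile k P ≐ DirectedProfile k Q → perm P ≈ perm Q

record IsMinimumIn[1,_] (m : ℕ) (R : Pred ℕ 0ℓ) (k : ℕ) : Set where
  field
    positive : 1 ℕ.≤ k
    bounded  : k ℕ.≤ m
    holds    : R k
    minimal  : ∀ j → 1 ℕ.≤ j → j ℕ.≤ m → R j → k ℕ.≤ j

-- k = k_u(n)
IsKᵘ : ℕ → ℕ → Set
IsKᵘ n k = IsMinimumIn[1, suc n ] (Reconstructing n) k

-- k = k_d(n)
IsKᵈ : ℕ → ℕ → Set
IsKᵈ n k = IsMinimumIn[1, suc n ] (DirectedReconstructing n) k

{-# OPTIONS --safe #-}

-- The full profile determines the permutation: if L precedes t and u, then the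
-- ranges from L to t and from L to u either tell which of t and u comes first,
-- or coincide, and then L can be replaced by one of their ends, located further
-- to the right. For n ≥ 5 the (n - 3)-profile determines the full one: it tells
-- whether n is between 2 and n - 1 and between 2 and n - 2, hence on which side
-- of n these elements are, and the remaining ambiguity between n - 1 and n - 2
-- is settled by the minimum between n - 1 and n; the elements 1, 2, 3 are
-- treated by symmetry. For n ≤ 4 all pairs of permutations are compared.
--
-- For the lower bounds, exchanging a and b (a < b < n) in the word
-- 0 a b 1 n … (n + 1) only changes the ranges from 0 and from 1 to a, and the
-- direction of (a, b). The undirected bound takes a = n - 2 and b = n - 1, the
-- directed one a = k + 2 and b = n - 1.

module Submission where

open import Defs
open import Data.Empty using (⊥)
open import Data.Fin.Base as Fin using (Fin; zero; suc; toℕ; fromℕ; opposite)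
open import Data.Fin.Patterns
open import Data.Fin.Permutation as Perm using (Permutation′; _⟨$⟩ʳ_; _⟨$⟩ˡ_)
import Data.Fin.Properties as Fin
open import Data.List.Base using (allFin)
import Data.List.Extrema as Extrema
open import Data.List.Membership.Propositional.Properties using (∈-allFin; ∈-filter⁺)
open import Data.List.Relation.Unary.All using (lookup)
open import Data.List.Relation.Unary.All.Properties using (all-filter)
open import Data.Nat.Base using (ℕ; zero; suc; _+_; _∸_; _⊔_; ⌈_/2⌉; _≤_; _<_; z≤n; s≤s)
import Data.Nat.Properties as ℕ
open import Data.Product.Base using (_×_; _,_; ∃-syntax; proj₁; proj₂)
open import Data.Sum.Base using (_⊎_; inj₁; inj₂)
import Data.Sum.Base as Sum
open import Data.Unit.Base using (⊤; tt)
open import Function.Base using (_∘_; id)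
open import Relation.Binary.Definitions using (tri<; tri≈; tri>)
open import Relation.Binary.PropositionalEquality
open import Relation.Nullary using (¬_; Dec; yes; no; contradiction)
open import Relation.Nullary.Decidable using (_×-dec_; _⊎-dec_; _→-dec_; dec-true; dec-false; from-yes; map′)
open import Relation.Unary using (_≐_)

private
  variable
    n k : ℕ

-- Positions, intervals and their extreme elements

pos : FramedPermutation n → Fin (2 + n) → ℕ
pos P x = toℕ (position P x)

module _ (P : FramedPermutation n) where

  position-injective : ∀ {x y} → position P x ≡ position P y → x ≡ y
  position-injective {x} {y} eq = begin
    x                            ≡⟨ Perm.inverseʳ (perm P) ⟨
    elementAt P (position P x)   ≡⟨ cong (elementAt P) eq ⟩
    elementAt P (position P y)   ≡⟨ Perm.inverseʳ (perm P) ⟩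
    y                            ∎
    where open ≡-Reasoning

  pos-injective : ∀ {x y} → pos P x ≡ pos P y → x ≡ y
  pos-injective = position-injective ∘ Fin.toℕ-injective

  position-unique : ∀ {p x} → elementAt P p ≡ x → position P x ≡ p
  position-unique refl = Perm.inverseˡ (perm P)

  before-or-after : ∀ {x y} → x ≢ y → pos P x < pos P y ⊎ pos P y < pos P x
  before-or-after {x} {y} x≢y with ℕ.<-cmp (pos P x) (pos P y)
  ... | tri< x◁y _ _ = inj₁ x◁y
  ... | tri≈ _ eq _  = contradiction (pos-injective eq) x≢y
  ... | tri> _ _ y◁x = inj₂ y◁x

  pos-0≤ : ∀ x → pos P 0F ≤ pos P x
  pos-0≤ x rewrite position-unique (leftmost P) = z≤n

  pos-≤last : ∀ x → pos P x ≤ pos P (fromℕ (suc n))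
  pos-≤last x rewrite position-unique (rightmost P) = Fin.≤fromℕ (position P x)

  pos-0< : ∀ {x} → x ≢ 0F → pos P 0F < pos P x
  pos-0< {x} x≢0 = ℕ.≤∧≢⇒< (pos-0≤ x) (x≢0 ∘ sym ∘ pos-injective)

  pos-<last : ∀ {x} → x ≢ fromℕ (suc n) → pos P x < pos P (fromℕ (suc n))
  pos-<last {x} x≢ = ℕ.≤∧≢⇒< (pos-≤last x) (x≢ ∘ pos-injective)

  between-left : ∀ t u → Between P t u t
  between-left t u with ℕ.≤-total (pos P t) (pos P u)
  ... | inj₁ t≤u = inj₁ (ℕ.≤-refl , t≤u)
  ... | inj₂ u≤t = inj₂ (u≤t , ℕ.≤-refl)

  between-swap : ∀ t u {x} → Between P t u x → Between P u t x
  between-swap t u = Sum.swap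

  between-right : ∀ t u → Between P t u u
  between-right t u = between-swap u t (between-left u t)

  between⁻ : ∀ {t u x} → pos P t ≤ pos P u → Between P t u x →
             pos P t ≤ pos P x × pos P x ≤ pos P u
  between⁻ t≤u (inj₁ b)           = b
  between⁻ t≤u (inj₂ (u≤x , x≤t)) = ℕ.≤-trans t≤u u≤x , ℕ.≤-trans x≤t t≤u

  module _ (t u : Fin (2 + n)) where
    open Extrema (Fin.≤-totalOrder (2 + n))

    minBetween-∈ : Between P t u (minBetween P t u)
    minBetween-∈ = argmin-all id {P = Between P t u} (between-left t u)
      (all-filter (between? P t u) (allFin _))

    maxBetween-∈ : Between P t u (maxBetween P t u)
    maxBetween-∈ = argmax-all id {P = Between P t u} (between-left t u)
      (all-filter (between? P t u) (allFin _))

    minBetween-≤ : ∀ {x} → Between P t u x → minBetween P t u Fin.≤ x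
    minBetween-≤ {x} b = lookup (min≤xs t (interval P t u))
      (∈-filter⁺ (between? P t u) (∈-allFin x) b)

    maxBetween-≥ : ∀ {x} → Between P t u x → x Fin.≤ maxBetween P t u
    maxBetween-≥ {x} b = lookup (xs≤max t (interval P t u))
      (∈-filter⁺ (between? P t u) (∈-allFin x) b)

-- Comparison of ranges

record SameRange (P Q : FramedPermutation n) (t u : Fin (2 + n)) : Set where
  constructor sameRange
  field
    min≡ : minBetween P t u ≡ minBetween Q t u
    max≡ : maxBetween P t u ≡ maxBetween Q t u

-- Pairwise form of the equality of two `k`-profiles, free of the witness `i`.
SameRanges : ℕ → (P Q : FramedPermutation n) → Set
SameRanges k P Q = ∀ {t u} → t Fin.< u → toℕ u ≤ toℕ t + k → SameRange P Q t u

sameRange-sym : ∀ {P Q : FramedPermutation n} {t u} → SameRange P Q t u → SameRange Q P t u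
sameRange-sym (sameRange mn mx) = sameRange (sym mn) (sym mx)

-- Weaker than inclusion of intervals: an element may drop out as long as others still bound it on
-- both sides. This is what an exchange of two elements leaves.
Covers : (P Q : FramedPermutation n) (t u : Fin (2 + n)) → Set
Covers P Q t u = ∀ x → Between Q t u x →
  (∃[ y ] Between P t u y × y Fin.≤ x) × (∃[ z ] Between P t u z × x Fin.≤ z)

minBetween-mono : ∀ (P Q : FramedPermutation n) t u t′ u′ →
  (∀ x → Between Q t′ u′ x → ∃[ y ] Between P t u y × y Fin.≤ x) →
  minBetween P t u Fin.≤ minBetween Q t′ u′
minBetween-mono P Q t u t′ u′ f with y , b , y≤ ← f _ (minBetween-∈ Q t′ u′) =
  ℕ.≤-trans (minBetween-≤ P t u b) y≤

maxBetween-mono : ∀ (P Q : FramedPermutation n) t u t′ u′ →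
  (∀ x → Between Q t′ u′ x → ∃[ y ] Between P t u y × x Fin.≤ y) →
  maxBetween Q t′ u′ Fin.≤ maxBetween P t u
maxBetween-mono P Q t u t′ u′ f with y , b , ≤y ← f _ (maxBetween-∈ Q t′ u′) =
  ℕ.≤-trans ≤y (maxBetween-≥ P t u b)

covers⇒sameRange : ∀ (P Q : FramedPermutation n) t u →
  Covers P Q t u → Covers Q P t u → SameRange P Q t u
covers⇒sameRange P Q t u c d = sameRange
  (Fin.≤-antisym (minBetween-mono P Q t u t u (λ x b → proj₁ (c x b)))
                 (minBetween-mono Q P t u t u (λ x b → proj₁ (d x b))))
  (Fin.≤-antisym (maxBetween-mono Q P t u t u (λ x b → proj₂ (d x b)))
                 (maxBetween-mono P Q t u t u (λ x b → proj₂ (c x b))))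

minBetween-comm : ∀ (P : FramedPermutation n) t u → minBetween P t u ≡ minBetween P u t
minBetween-comm P t u = Fin.≤-antisym
  (minBetween-mono P P t u u t λ x b → x , between-swap P u t b , ℕ.≤-refl)
  (minBetween-mono P P u t t u λ x b → x , between-swap P t u b , ℕ.≤-refl)

maxBetween-comm : ∀ (P : FramedPermutation n) t u → maxBetween P t u ≡ maxBetween P u t
maxBetween-comm P t u = Fin.≤-antisym
  (maxBetween-mono P P u t t u λ x b → x , between-swap P t u b , ℕ.≤-refl)
  (maxBetween-mono P P t u u t λ x b → x , between-swap P u t b , ℕ.≤-refl)

sameRange-comm : ∀ (P Q : FramedPermutation n) {t u} → SameRange P Q t u → SameRange P Q u t
sameRange-comm P Q {t} {u} (sameRange mn mx) = sameRange
  (trans (minBetween-comm P u t) (trans mn (minBetween-comm Q t u)))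
  (trans (maxBetween-comm P u t) (trans mx (maxBetween-comm Q t u)))

-- With explicit ends, two permutations can be compared by exhibiting the same two elements for
-- both, without computing a minimum or a maximum.
record Spans (P : FramedPermutation n) (t u lo hi : Fin (2 + n)) : Set where
  constructor spanning
  field
    lo∈    : Between P t u lo
    hi∈    : Between P t u hi
    bounds : ∀ x → Between P t u x → lo Fin.≤ x × x Fin.≤ hi

spans⇒sameRange : ∀ (P Q : FramedPermutation n) {t u lo hi} →
  Spans P t u lo hi → Spans Q t u lo hi → SameRange P Q t u
spans⇒sameRange P Q (spanning loP hiP inP) (spanning loQ hiQ inQ) = covers⇒sameRange P Q _ _
  (λ x b → (_ , loP , proj₁ (inQ x b)) , (_ , hiP , proj₂ (inQ x b)))
  (λ x b → (_ , loQ , proj₁ (inP x b)) , (_ , hiQ , proj₂ (inP x b)))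

-- Profiles as families of ranges

constraint∈profile : ∀ (P : FramedPermutation n) {t u} → t Fin.< u → toℕ u ≤ toℕ t + k →
  Profile k P ⟨ t , u ,[ minBetween P t u , maxBetween P t u ]⟩
constraint∈profile {k = k} P {t} {u} t<u u≤t+k =
  toℕ u ∸ toℕ t , ℕ.m<n⇒0<n∸m t<u ,
  ℕ.≤-trans (ℕ.∸-monoˡ-≤ (toℕ t) u≤t+k) (ℕ.≤-reflexive (ℕ.m+n∸m≡n (toℕ t) k)) ,
  sym (ℕ.m+[n∸m]≡n (ℕ.<⇒≤ t<u)) , refl , refl

profile⇒sameRanges : ∀ (P Q : FramedPermutation n) → Profile k P ≐ Profile k Q → SameRanges k P Q
profile⇒sameRanges P Q (⊆ , _) {t} {u} t<u u≤t+k
  with _ , _ , _ , _ , mn , mx ← ⊆ {⟨ t , u ,[ minBetween P t u , maxBetween P t u ]⟩}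
    (constraint∈profile P t<u u≤t+k) = sameRange mn mx

sameRanges⇒profile⊆ : ∀ (P Q : FramedPermutation n) → SameRanges k P Q →
  ∀ {c} → Profile k P c → Profile k Q c
sameRanges⇒profile⊆ P Q S {⟨ t , u ,[ _ , _ ]⟩} (i , 1≤i , i≤k , u≡t+i , mn , mx) =
  i , 1≤i , i≤k , u≡t+i , trans mn (SameRange.min≡ same) , trans mx (SameRange.max≡ same)
  where
  same : SameRange P Q t u
  same = S (subst (toℕ t <_) (sym u≡t+i) (ℕ.m<m+n (toℕ t) 1≤i))
           (subst (_≤ toℕ t + _) (sym u≡t+i) (ℕ.+-monoʳ-≤ (toℕ t) i≤k))

sameRanges-sym : ∀ (P Q : FramedPermutation n) → SameRanges k P Q → SameRanges k Q P
sameRanges-sym P Q S t<u u≤ = sameRange-sym {P = P} {Q} (S t<u u≤)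

sameRanges⇒profile : ∀ (P Q : FramedPermutation n) → SameRanges k P Q → Profile k P ≐ Profile k Q
sameRanges⇒profile P Q S =
  sameRanges⇒profile⊆ P Q S , sameRanges⇒profile⊆ Q P (sameRanges-sym P Q S)

-- The order of positions determines the permutation

SameOrder : (P Q : FramedPermutation n) → Set
SameOrder P Q = ∀ {x y} → pos P x < pos P y → pos Q x < pos Q y

sameOrder-sym : ∀ (P Q : FramedPermutation n) → SameOrder P Q → SameOrder Q P
sameOrder-sym P Q P⇒Q {x} {y} x◁y with before-or-after P (λ x≡y → ℕ.<⇒≢ x◁y (cong (pos Q) x≡y))
... | inj₁ x◁ᴾy = x◁ᴾy
... | inj₂ y◁ᴾx = contradiction x◁y (ℕ.<-asym (P⇒Q y◁ᴾx))

-- Induction on the position: the element just before `x` in `P` has in `Q` at least the position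
-- that it has in `P`, and `x` comes strictly after it there.
sameOrder⇒pos≤ : ∀ (P Q : FramedPermutation n) → SameOrder P Q → ∀ x → pos P x ≤ pos Q x
sameOrder⇒pos≤ {n} P Q P⇒Q x = go (pos P x) x refl
  where
  go : ∀ d x → pos P x ≡ d → d ≤ pos Q x
  go zero    x eq = z≤n
  go (suc d) x eq = ℕ.≤-<-trans (go d y y-eq) (P⇒Q (subst₂ _<_ (sym y-eq) (sym eq) ℕ.≤-refl))
    where
    d<m : d < 2 + n
    d<m = ℕ.<-trans (ℕ.≤-reflexive (sym eq)) (Fin.toℕ<n (position P x))
    y : Fin (2 + n)
    y = elementAt P (Fin.fromℕ< d<m)
    y-eq : pos P y ≡ d
    y-eq = trans (cong toℕ (position-unique P refl)) (Fin.toℕ-fromℕ< d<m)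

sameOrder⇒≈ : ∀ (P Q : FramedPermutation n) → SameOrder P Q → perm P Perm.≈ perm Q
sameOrder⇒≈ P Q P⇒Q p = begin
  elementAt P p                                ≡⟨ Perm.inverseʳ (perm Q) ⟨
  elementAt Q (position Q (elementAt P p))     ≡⟨ cong (elementAt Q) (samePosition (elementAt P p)) ⟨
  elementAt Q (position P (elementAt P p))     ≡⟨ cong (elementAt Q) (position-unique P refl) ⟩
  elementAt Q p                                ∎
  where
  open ≡-Reasoning
  samePosition : ∀ x → position P x ≡ position Q x
  samePosition x = Fin.≤-antisym (sameOrder⇒pos≤ P Q P⇒Q x)
                                 (sameOrder⇒pos≤ Q P (sameOrder-sym P Q P⇒Q) x)

-- The full profile determines the order

module _ (P Q : FramedPermutation n) (same : ∀ t u → t ≢ u → SameRange P Q t u) where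

  -- If t and u are inverted, the four intervals from L to t and to u in P and Q
  -- have the same range; its ends precede t and u on both sides, and one of
  -- them differs from L, so that it can replace L.
  no-inversion : ∀ d L t u → 2 + n ≤ pos P L + d →
    pos P L < pos P t → pos Q L < pos Q u → pos P t < pos P u → pos Q u < pos Q t → ⊥
  -- `d` bounds the number of positions left from `L` on; with none left, `L` would be located
  -- outside the word.
  no-inversion zero L t u m≤ _ _ _ _ =
    ℕ.<⇒≱ (Fin.toℕ<n (position P L)) (ℕ.≤-trans m≤ (ℕ.≤-reflexive (ℕ.+-identityʳ _)))
  no-inversion (suc d) L t u m≤ L◁t L◁u t◁u u◁t = both-ends
    where
    L≢t : L ≢ t
    L≢t refl = ℕ.<-irrefl refl L◁t

    L≢u : L ≢ u
    L≢u refl = ℕ.<-irrefl refl L◁u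

    P-⊆ : ∀ x → Between P L t x → Between P L u x
    P-⊆ x b with L≤x , x≤t ← between⁻ P (ℕ.<⇒≤ L◁t) b =
      inj₁ (L≤x , ℕ.≤-trans x≤t (ℕ.<⇒≤ t◁u))

    Q-⊆ : ∀ x → Between Q L u x → Between Q L t x
    Q-⊆ x b with L≤x , x≤u ← between⁻ Q (ℕ.<⇒≤ L◁u) b =
      inj₁ (L≤x , ℕ.≤-trans x≤u (ℕ.<⇒≤ u◁t))

    -- The interval to `t` is contained in the one to `u` in `P`, and contains it in `Q`; through
    -- the shared ranges, these inclusions give opposite inequalities.
    min-eq : minBetween P L t ≡ minBetween Q L u
    min-eq = Fin.≤-antisym
      (subst (Fin._≤ minBetween Q L u) (sym (SameRange.min≡ (same L t L≢t)))
        (minBetween-mono Q Q L t L u λ x b → x , Q-⊆ x b , ℕ.≤-refl))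
      (subst (Fin._≤ minBetween P L t) (SameRange.min≡ (same L u L≢u))
        (minBetween-mono P P L u L t λ x b → x , P-⊆ x b , ℕ.≤-refl))

    max-eq : maxBetween P L t ≡ maxBetween Q L u
    max-eq = Fin.≤-antisym
      (subst (maxBetween P L t Fin.≤_) (SameRange.max≡ (same L u L≢u))
        (maxBetween-mono P P L u L t λ x b → x , P-⊆ x b , ℕ.≤-refl))
      (subst (maxBetween Q L u Fin.≤_) (sym (SameRange.max≡ (same L t L≢t)))
        (maxBetween-mono Q Q L t L u λ x b → x , Q-⊆ x b , ℕ.≤-refl))

    advance : ∀ a → Between P L t a → Between Q L u a → a ≢ L → ⊥
    advance a bP bQ a≢L
      with L≤a , a≤t ← between⁻ P (ℕ.<⇒≤ L◁t) bP | _ , a≤u ← between⁻ Q (ℕ.<⇒≤ L◁u) bQ =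
      no-inversion d a t u
        (ℕ.≤-trans m≤ (ℕ.≤-trans (ℕ.≤-reflexive (ℕ.+-suc (pos P L) d)) (ℕ.+-monoˡ-≤ d L◁a)))
        -- `a` is neither `t`, which comes after `u` in `Q`, nor `u`, which comes after `t` in `P`.
        (ℕ.≤∧≢⇒< a≤t λ eq → ℕ.<⇒≱ u◁t (subst (λ a → pos Q a ≤ pos Q u) (pos-injective P eq) a≤u))
        (ℕ.≤∧≢⇒< a≤u λ eq → ℕ.<⇒≱ t◁u (subst (λ a → pos P a ≤ pos P t) (pos-injective Q eq) a≤t))
        t◁u u◁t
      where
      L◁a : pos P L < pos P a
      L◁a = ℕ.≤∧≢⇒< L≤a (a≢L ∘ sym ∘ pos-injective P)

    both-ends : ⊥
    both-ends with minBetween P L t Fin.≟ L | maxBetween P L t Fin.≟ L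
    ... | no ≢L  | _      = advance _ (minBetween-∈ P L t)
                              (subst (Between Q L u) (sym min-eq) (minBetween-∈ Q L u)) ≢L
    ... | yes _  | no ≢L  = advance _ (maxBetween-∈ P L t)
                              (subst (Between Q L u) (sym max-eq) (maxBetween-∈ Q L u)) ≢L
    -- A range reduced to `L` but containing `t` would make `t` equal to `L`.
    ... | yes ≡L | yes ≡L′ = L≢t (Fin.≤-antisym
      (subst (Fin._≤ t) ≡L (minBetween-≤ P L t (between-right P L t)))
      (subst (t Fin.≤_) ≡L′ (maxBetween-≥ P L t (between-right P L t))))

  sameRange⇒sameOrder : SameOrder P Q
  sameRange⇒sameOrder {t} {u} t◁u with t Fin.≟ 0F
  ... | yes refl = pos-0< Q λ { refl → ℕ.<-irrefl refl t◁u }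
  ... | no t≢0 with before-or-after Q {t} {u} (λ { refl → ℕ.<-irrefl refl t◁u })
  ...   | inj₁ t◁ᵠu = t◁ᵠu
  ...   | inj₂ u◁ᵠt = contradiction
    -- The descent starts from 0, which precedes everything, with fuel for the whole word.
    (no-inversion (2 + n) 0F t u (ℕ.m≤n+m _ _) (pos-0< P t≢0) (pos-0< Q u≢0) t◁u u◁ᵠt) λ ()
    where
    u≢0 : u ≢ 0F
    u≢0 refl = ℕ.<⇒≱ t◁u (pos-0≤ P t)

-- Sides relative to a given element

Agree : (P Q : FramedPermutation n) (x y : Fin (2 + n)) → Set
Agree P Q x y = (pos P x < pos P y → pos Q x < pos Q y) × (pos P y < pos P x → pos Q y < pos Q x)

module _ (P Q : FramedPermutation n) where

  agree-sym : ∀ {x y} → x ≢ y → Agree P Q x y → Agree Q P x y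
  agree-sym {x} {y} x≢y (f , g) with before-or-after P x≢y
  ... | inj₁ x◁y = (λ _ → x◁y) , λ y◁ᵠx → contradiction y◁ᵠx (ℕ.<-asym (f x◁y))
  ... | inj₂ y◁x = (λ x◁ᵠy → contradiction x◁ᵠy (ℕ.<-asym (g y◁x))) , λ _ → y◁x

  -- Whether h lies between x and y tells the side of h on which y is located
  -- once it is known for x.
  agree-shift : ∀ {x y h} → x ≢ h → y ≢ h →
    (Between P x y h → Between Q x y h) → (Between Q x y h → Between P x y h) →
    Agree P Q x h → Agree P Q y h
  agree-shift {x} {y} {h} x≢h y≢h P⇒Q Q⇒P (f , g) = to , from
    where
    -- If the sides of `y` differed, `h` would lie between `x` and `y` in exactly one of `P` and
    -- `Q`.
    to : pos P y < pos P h → pos Q y < pos Q h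
    to y◁h with before-or-after Q y≢h
    ... | inj₁ y◁ᵠh = y◁ᵠh
    ... | inj₂ h◁ᵠy with before-or-after P x≢h
    ...   | inj₁ x◁h with Q⇒P (inj₁ (ℕ.<⇒≤ (f x◁h) , ℕ.<⇒≤ h◁ᵠy))
    ...     | inj₁ (_ , h≤y) = contradiction h≤y (ℕ.<⇒≱ y◁h)
    ...     | inj₂ (_ , h≤x) = contradiction h≤x (ℕ.<⇒≱ x◁h)
    to y◁h | inj₂ h◁ᵠy | inj₂ h◁x with P⇒Q (inj₂ (ℕ.<⇒≤ y◁h , ℕ.<⇒≤ h◁x))
    ...     | inj₁ (x≤h , _) = contradiction x≤h (ℕ.<⇒≱ (g h◁x))
    ...     | inj₂ (y≤h , _) = contradiction y≤h (ℕ.<⇒≱ h◁ᵠy)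

    from : pos P h < pos P y → pos Q h < pos Q y
    from h◁y with before-or-after Q y≢h
    ... | inj₂ h◁ᵠy = h◁ᵠy
    ... | inj₁ y◁ᵠh with before-or-after P x≢h
    ...   | inj₁ x◁h with P⇒Q (inj₁ (ℕ.<⇒≤ x◁h , ℕ.<⇒≤ h◁y))
    ...     | inj₁ (_ , h≤y) = contradiction h≤y (ℕ.<⇒≱ y◁ᵠh)
    ...     | inj₂ (_ , h≤x) = contradiction h≤x (ℕ.<⇒≱ (f x◁h))
    from h◁y | inj₁ y◁ᵠh | inj₂ h◁x with Q⇒P (inj₂ (ℕ.<⇒≤ y◁ᵠh , ℕ.<⇒≤ (g h◁x)))
    ...     | inj₁ (x≤h , _) = contradiction x≤h (ℕ.<⇒≱ h◁x)
    ...     | inj₂ (y≤h , _) = contradiction y≤h (ℕ.<⇒≱ h◁y)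

  agree⇒between : ∀ {x y h} → x ≢ h → y ≢ h → Agree P Q x h → Agree P Q y h →
    Between P x y h → Between Q x y h
  agree⇒between {x} {y} {h} x≢h y≢h (x◁ , ◁x) (y◁ , ◁y) = Sum.map
    (λ (x≤h , h≤y) → ℕ.<⇒≤ (x◁ (strict x≢h x≤h)) , ℕ.<⇒≤ (◁y (strict (y≢h ∘ sym) h≤y)))
    (λ (y≤h , h≤x) → ℕ.<⇒≤ (y◁ (strict y≢h y≤h)) , ℕ.<⇒≤ (◁x (strict (x≢h ∘ sym) h≤x)))
    where
    strict : ∀ {v w} → v ≢ w → pos P v ≤ pos P w → pos P v < pos P w
    strict v≢w v≤w = ℕ.≤∧≢⇒< v≤w (v≢w ∘ pos-injective P)

module _ (P : FramedPermutation n) where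

  0∉between : ∀ {t u x} → t ≢ 0F → u ≢ 0F → Between P t u x → x ≢ 0F
  0∉between t≢0 u≢0 (inj₁ (t≤x , _)) refl = ℕ.<⇒≱ (pos-0< P t≢0) t≤x
  0∉between t≢0 u≢0 (inj₂ (u≤x , _)) refl = ℕ.<⇒≱ (pos-0< P u≢0) u≤x

  last∉between : ∀ {t u x} → t ≢ fromℕ (suc n) → u ≢ fromℕ (suc n) →
    Between P t u x → x ≢ fromℕ (suc n)
  last∉between t≢ u≢ (inj₁ (_ , x≤u)) refl = ℕ.<⇒≱ (pos-<last P u≢) x≤u
  last∉between t≢ u≢ (inj₂ (_ , x≤t)) refl = ℕ.<⇒≱ (pos-<last P t≢) x≤t

  -- The interval from 0 is a prefix of the word, so its minimum is 0 and only the maximum has to be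
  -- found; `n + 1` is left out because it comes last.
  spans-0 : ∀ {y} z → y ≢ fromℕ (suc n) → pos P z ≤ pos P y →
    (∀ x → x ≢ fromℕ (suc n) → pos P x ≤ pos P y → x Fin.≤ z) → Spans P 0F y 0F z
  spans-0 {y} z y≢ z≤y bound = spanning (between-left P 0F y) (inj₁ (pos-0≤ P z , z≤y))
    λ x b → z≤n , bound x (last∉between (λ ()) y≢ b) (proj₂ (between⁻ P (pos-0≤ P y) b))

-- The largest elements, for `n = 5 + i`

module _ {i : ℕ} where

  -- The elements `n + 1`, `n`, `n - 1` and `n - 2`. Those after `top` are written with `opposite`
  -- because mirror images will exchange them with 1, 2 and 3. The bound `n - 3` of the theorem is
  -- `2 + i`.
  top h h₁ h₂ : Fin (7 + i)
  top = fromℕ (6 + i)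
  h   = opposite 1F
  h₁  = opposite 2F
  h₂  = opposite 3F

  toℕ-h : toℕ h ≡ 5 + i
  toℕ-h = Fin.opposite-prop {7 + i} 1F

  toℕ-h₁ : toℕ h₁ ≡ 4 + i
  toℕ-h₁ = Fin.opposite-prop {7 + i} 2F

  toℕ-h₂ : toℕ h₂ ≡ 3 + i
  toℕ-h₂ = Fin.opposite-prop {7 + i} 3F

  ≤-pred : ∀ {x y : Fin (7 + i)} {v} → toℕ y ≡ suc v → x ≢ y → toℕ x ≤ suc v → toℕ x ≤ v
  ≤-pred y≡ x≢y x≤ = ℕ.≤-pred (ℕ.≤∧≢⇒< x≤ λ eq → x≢y (Fin.toℕ-injective (trans eq (sym y≡))))

  ≤h : ∀ {x} → x ≢ top → x Fin.≤ h
  ≤h {x} x≢ rewrite toℕ-h = ≤-pred (Fin.toℕ-fromℕ _) x≢ (ℕ.≤-pred (Fin.toℕ<n x))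

  ≤h₁ : ∀ {x} → x ≢ top → x ≢ h → x Fin.≤ h₁
  ≤h₁ {x} x≢top x≢h rewrite toℕ-h₁ = ≤-pred toℕ-h x≢h (subst (toℕ x ≤_) toℕ-h (≤h x≢top))

  ≤h₂ : ∀ {x} → x ≢ top → x ≢ h → x ≢ h₁ → x Fin.≤ h₂
  ≤h₂ {x} x≢top x≢h x≢h₁ rewrite toℕ-h₂ =
    ≤-pred toℕ-h₁ x≢h₁ (subst (toℕ x ≤_) toℕ-h₁ (≤h₁ x≢top x≢h))

  <⇒≢ : ∀ {x y : Fin (7 + i)} {v w} → toℕ x ≡ v → toℕ y ≡ w → v < w → x ≢ y
  <⇒≢ refl refl v<w refl = ℕ.<-irrefl refl v<w

  h≢top : h ≢ top
  h≢top = <⇒≢ toℕ-h (Fin.toℕ-fromℕ _) ℕ.≤-refl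

  h₁≢top : h₁ ≢ top
  h₁≢top = <⇒≢ toℕ-h₁ (Fin.toℕ-fromℕ _) (ℕ.m≤n+m _ 1)

  h₂≢top : h₂ ≢ top
  h₂≢top = <⇒≢ toℕ-h₂ (Fin.toℕ-fromℕ _) (ℕ.m≤n+m _ 2)

  h₁≢h : h₁ ≢ h
  h₁≢h = <⇒≢ toℕ-h₁ toℕ-h ℕ.≤-refl

  h₂≢h : h₂ ≢ h
  h₂≢h = <⇒≢ toℕ-h₂ toℕ-h (ℕ.m≤n+m _ 1)

  h₂≢h₁ : h₂ ≢ h₁
  h₂≢h₁ = <⇒≢ toℕ-h₂ toℕ-h₁ ℕ.≤-refl

  0≢h : 0F ≢ h
  0≢h = <⇒≢ refl toℕ-h (s≤s z≤n)

  1≢h : 1F ≢ h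
  1≢h = <⇒≢ refl toℕ-h (s≤s (s≤s z≤n))

  2≢h : 2F ≢ h
  2≢h = <⇒≢ refl toℕ-h (s≤s (s≤s (s≤s z≤n)))

  h₁≢0 : h₁ ≢ 0F
  h₁≢0 = <⇒≢ refl toℕ-h₁ (s≤s z≤n) ∘ sym

  -- An interval avoiding `n + 1` contains `n` exactly when `n` is its maximum, and the maximum is
  -- shared.
  h∈between : ∀ (P Q : FramedPermutation (5 + i)) {t u} → t ≢ top → u ≢ top →
    SameRange P Q t u → Between P t u h → Between Q t u h
  h∈between P Q {t} {u} t≢ u≢ (sameRange _ mx) b =
    subst (Between Q t u) (trans (sym mx) max≡h) (maxBetween-∈ Q t u)
    where
    max≡h : maxBetween P t u ≡ h
    max≡h = Fin.≤-antisym (≤h (last∉between P t≢ u≢ (maxBetween-∈ P t u))) (maxBetween-≥ P t u b)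

  module _ (P Q : FramedPermutation (5 + i)) (S : SameRanges (2 + i) P Q) where

    private
      shift-h : ∀ x y → x ≢ top → y ≢ top → x ≢ h → y ≢ h → SameRange P Q x y →
        Agree P Q x h → Agree P Q y h
      shift-h x y x≢top y≢top x≢h y≢h same = agree-shift P Q x≢h y≢h
        (h∈between P Q x≢top y≢top same)
        (h∈between Q P x≢top y≢top (sameRange-sym {P = P} {Q} same))

      agree-0 : Agree P Q 0F h
      agree-0 = (λ _ → pos-0< Q (0≢h ∘ sym)) , λ h◁0 → contradiction h◁0 (ℕ.≤⇒≯ (pos-0≤ P h))

    agree-1-h : Agree P Q 1F h
    agree-1-h = shift-h 0F 1F (λ ()) (λ ()) 0≢h 1≢h (S (s≤s z≤n) (s≤s z≤n)) agree-0

    -- 2 serves as a relay between 0, whose side of `h` is obvious, and the large elements: it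
    -- differs from `h₁` by exactly `2 + i`, whereas 1 would be one too far.
    agree-2-h : Agree P Q 2F h
    agree-2-h = shift-h 0F 2F (λ ()) (λ ()) 0≢h 2≢h (S (s≤s z≤n) (s≤s (s≤s z≤n))) agree-0

    agree-h₁-h : Agree P Q h₁ h
    agree-h₁-h = shift-h 2F h₁ (λ ()) h₁≢top 2≢h h₁≢h
      (S (subst (2 <_) (sym toℕ-h₁) (s≤s (s≤s (s≤s z≤n)))) (ℕ.≤-reflexive toℕ-h₁)) agree-2-h

    agree-h₂-h : Agree P Q h₂ h
    agree-h₂-h = shift-h 2F h₂ (λ ()) h₂≢top 2≢h h₂≢h
      (S (subst (2 <_) (sym toℕ-h₂) (s≤s (s≤s (s≤s z≤n))))
         (ℕ.≤-trans (ℕ.≤-reflexive toℕ-h₂) (ℕ.m≤n+m _ 1))) agree-2-h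

    -- For x = min(h₁, h), the maximum between x and h₂ is h₁ in Q but not in P.
    no-inversion-h₁-h₂ : pos P h₁ < pos P h₂ → pos Q h₂ < pos Q h₁ →
      pos P h₂ < pos P h → pos Q h₁ < pos Q h → ⊥
    no-inversion-h₁-h₂ h₁◁h₂ h₂◁h₁ h₂◁h h₁◁h = ℕ.<⇒≱ h₁◁h₂
      (between-before (subst (Between P x h₂) maxP≡h₁ (maxBetween-∈ P x h₂)))
      where
      x : Fin (7 + i)
      x = minBetween P h₁ h

      xP : pos P h₁ ≤ pos P x × pos P x ≤ pos P h
      xP = between⁻ P (ℕ.<⇒≤ (ℕ.<-trans h₁◁h₂ h₂◁h)) (minBetween-∈ P h₁ h)

      -- `h₁` and `h` are consecutive values, so their minimum is shared and `x` lies between them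
      -- in `Q` as well.
      x∈Q : Between Q h₁ h x
      x∈Q = subst (Between Q h₁ h)
        (sym (SameRange.min≡ (S (subst₂ _<_ (sym toℕ-h₁) (sym toℕ-h) ℕ.≤-refl)
                       (subst₂ (λ a b → a ≤ b + (2 + i)) (sym toℕ-h) (sym toℕ-h₁)
                         (ℕ.≤-trans (ℕ.≤-reflexive (ℕ.+-comm 1 (4 + i))) (ℕ.+-monoʳ-≤ (4 + i) (s≤s z≤n)))))))
        (minBetween-∈ Q h₁ h)

      xQ : pos Q h₁ ≤ pos Q x × pos Q x ≤ pos Q h
      xQ = between⁻ Q (ℕ.<⇒≤ h₁◁h) x∈Q

      x≢0 : x ≢ 0F
      x≢0 = 0∉between Q h₁≢0 (0≢h ∘ sym) x∈Q

      x≢h₂ : x ≢ h₂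
      x≢h₂ eq = ℕ.<⇒≱ h₂◁h₁ (subst (λ x → pos Q h₁ ≤ pos Q x) eq (proj₁ xQ))

      x≤h₂ : x Fin.≤ h₂
      x≤h₂ = minBetween-≤ P h₁ h (inj₁ (ℕ.<⇒≤ h₁◁h₂ , ℕ.<⇒≤ h₂◁h))

      x≢h : x ≢ h
      x≢h eq = ℕ.<⇒≱ (subst₂ _<_ (sym toℕ-h₂) (sym toℕ-h) (ℕ.m≤n+m _ 1))
                     (subst (Fin._≤ h₂) eq x≤h₂)

      x≢h₁ : x ≢ h₁
      x≢h₁ eq = ℕ.<⇒≱ (subst₂ _<_ (sym toℕ-h₂) (sym toℕ-h₁) ℕ.≤-refl)
                      (subst (Fin._≤ h₂) eq x≤h₂)

      x≢top : x ≢ top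
      x≢top = last∉between Q h₁≢top h≢top x∈Q

      -- Since `x` is at least 1, it differs from `h₂ = 3 + i` by at most `2 + i`.
      same : SameRange P Q x h₂
      same = S (ℕ.≤∧≢⇒< x≤h₂ (x≢h₂ ∘ Fin.toℕ-injective))
        (ℕ.≤-trans (ℕ.≤-reflexive toℕ-h₂) (ℕ.+-monoˡ-≤ (2 + i) (ℕ.n≢0⇒n>0 (x≢0 ∘ Fin.toℕ-injective))))

      h₂≤x : pos Q h₂ ≤ pos Q x
      h₂≤x = ℕ.≤-trans (ℕ.<⇒≤ h₂◁h₁) (proj₁ xQ)

      -- In `Q` the order is `h₂`, `h₁`, `x`, `h`: the interval contains `h₁` and stops before `h`.
      maxQ≡h₁ : maxBetween Q x h₂ ≡ h₁
      maxQ≡h₁ = Fin.≤-antisym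
        (≤h₁ (last∉between Q x≢top h₂≢top (maxBetween-∈ Q x h₂))
          λ eq → x≢h (pos-injective Q (ℕ.≤-antisym (proj₂ xQ)
            (subst (λ y → pos Q y ≤ pos Q x) eq
              (proj₂ (between⁻ Q h₂≤x (between-swap Q x h₂ (maxBetween-∈ Q x h₂))))))))
        (maxBetween-≥ Q x h₂ (inj₂ (ℕ.<⇒≤ h₂◁h₁ , proj₁ xQ)))

      maxP≡h₁ : maxBetween P x h₂ ≡ h₁
      maxP≡h₁ = trans (SameRange.max≡ same) maxQ≡h₁

      -- `h₁` strictly precedes `x` in `P`, so it could lie between `x` and `h₂` only by following
      -- `h₂`.
      between-before : Between P x h₂ h₁ → pos P h₂ ≤ pos P h₁
      between-before (inj₁ (x≤h₁ , _)) =
        contradiction (pos-injective P (ℕ.≤-antisym x≤h₁ (proj₁ xP))) x≢h₁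
      between-before (inj₂ (h₂≤h₁ , _)) = h₂≤h₁

  -- Ranges from 0 and 1 to `n - 1` and `n - 2`

  module _ (P Q : FramedPermutation (5 + i)) (S : SameRanges (2 + i) P Q) where

    private
      not-after : ∀ {R : FramedPermutation (5 + i)} {x y z} → pos R z ≤ pos R y → pos R y < pos R x → z ≢ x
      not-after z≤y y<x refl = ℕ.<⇒≱ y<x z≤y

      spans-h : ∀ R {y} → y ≢ top → pos R h < pos R y → Spans R 0F y 0F h
      spans-h R y≢ h◁y = spans-0 R h y≢ (ℕ.<⇒≤ h◁y) λ x x≢ _ → ≤h x≢

    -- The maximum of the prefix ending at `h₁` is `h` or `h₁`, according to the side of `h`, on
    -- which `P` and `Q` agree.
    sameRange-0-h₁ : SameRange P Q 0F h₁
    sameRange-0-h₁ with before-or-after P h₁≢h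
    ... | inj₂ h◁h₁ = spans⇒sameRange P Q (spans-h P h₁≢top h◁h₁)
      (spans-h Q h₁≢top (proj₂ (agree-h₁-h P Q S) h◁h₁))
    ... | inj₁ h₁◁h = spans⇒sameRange P Q (spans P h₁◁h) (spans Q (proj₁ (agree-h₁-h P Q S) h₁◁h))
      where
      spans : ∀ R → pos R h₁ < pos R h → Spans R 0F h₁ 0F h₁
      spans R h₁◁h = spans-0 R h₁ h₁≢top ℕ.≤-refl λ x x≢ x≤h₁ → ≤h₁ x≢ (not-after {R} x≤h₁ h₁◁h)

    -- If `h` does not come before `h₂`, the maximum of the prefix is `h₁` or `h₂`, whichever comes
    -- first; `no-inversion-h₁-h₂` rules out a disagreement.
    sameRange-0-h₂ : SameRange P Q 0F h₂
    sameRange-0-h₂ with before-or-after P h₂≢h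
    ... | inj₂ h◁h₂ = spans⇒sameRange P Q (spans-h P h₂≢top h◁h₂)
      (spans-h Q h₂≢top (proj₂ (agree-h₂-h P Q S) h◁h₂))
    ... | inj₁ h₂◁h = cases (before-or-after P h₂≢h₁) (before-or-after Q h₂≢h₁)
      where
      h₂◁ᵠh : pos Q h₂ < pos Q h
      h₂◁ᵠh = proj₁ (agree-h₂-h P Q S) h₂◁h

      spans-h₂ : ∀ R → pos R h₂ < pos R h → pos R h₂ < pos R h₁ → Spans R 0F h₂ 0F h₂
      spans-h₂ R h₂◁h h₂◁h₁ = spans-0 R h₂ h₂≢top ℕ.≤-refl λ x x≢ x≤h₂ →
        ≤h₂ x≢ (not-after {R} x≤h₂ h₂◁h) (not-after {R} x≤h₂ h₂◁h₁)

      spans-h₁ : ∀ R → pos R h₂ < pos R h → pos R h₁ < pos R h₂ → Spans R 0F h₂ 0F h₁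
      spans-h₁ R h₂◁h h₁◁h₂ = spans-0 R h₁ h₂≢top (ℕ.<⇒≤ h₁◁h₂) λ x x≢ x≤h₂ →
        ≤h₁ x≢ (not-after {R} x≤h₂ h₂◁h)

      cases : pos P h₂ < pos P h₁ ⊎ pos P h₁ < pos P h₂ → pos Q h₂ < pos Q h₁ ⊎ pos Q h₁ < pos Q h₂ →
              SameRange P Q 0F h₂
      cases (inj₁ p) (inj₁ q) = spans⇒sameRange P Q (spans-h₂ P h₂◁h p) (spans-h₂ Q h₂◁ᵠh q)
      cases (inj₂ p) (inj₂ q) = spans⇒sameRange P Q (spans-h₁ P h₂◁h p) (spans-h₁ Q h₂◁ᵠh q)
      -- Where `h₁` precedes `h₂` it also precedes `h`, and the side of `h` carries over to the
      -- other permutation.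
      cases (inj₂ p) (inj₁ q) = contradiction
        (no-inversion-h₁-h₂ P Q S p q h₂◁h (proj₁ (agree-h₁-h P Q S) (ℕ.<-trans p h₂◁h))) λ ()
      cases (inj₁ p) (inj₂ q) = contradiction
        (no-inversion-h₁-h₂ Q P (sameRanges-sym P Q S) q p h₂◁ᵠh
          (proj₁ (agree-h₁-h Q P (sameRanges-sym P Q S)) (ℕ.<-trans q h₂◁ᵠh))) λ ()

    -- With 0 outside the interval the minimum is 1; the maximum is `h` or `h₁`, depending on
    -- whether `h` is between them, which its sides relative to both ends decide.
    sameRange-1-h₁ : SameRange P Q 1F h₁
    sameRange-1-h₁ with between? P 1F h₁ h
    ... | yes b = spans⇒sameRange P Q (spans P b)
      (spans Q (agree⇒between P Q 1≢h h₁≢h (agree-1-h P Q S) (agree-h₁-h P Q S) b))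
      where
      spans : ∀ R → Between R 1F h₁ h → Spans R 1F h₁ 1F h
      spans R b = spanning (between-left R 1F h₁) b λ x b →
        ℕ.n≢0⇒n>0 (0∉between R (λ ()) h₁≢0 b ∘ Fin.toℕ-injective) ,
        ≤h (last∉between R (λ ()) h₁≢top b)
    ... | no ¬b = spans⇒sameRange P Q (spans P ¬b)
      (spans Q (¬b ∘ agree⇒between Q P 1≢h h₁≢h
        (agree-sym P Q 1≢h (agree-1-h P Q S)) (agree-sym P Q h₁≢h (agree-h₁-h P Q S))))
      where
      spans : ∀ R → ¬ Between R 1F h₁ h → Spans R 1F h₁ 1F h₁
      spans R ¬b = spanning (between-left R 1F h₁) (between-right R 1F h₁) λ x b →
        ℕ.n≢0⇒n>0 (0∉between R (λ ()) h₁≢0 b ∘ Fin.toℕ-injective) ,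
        ≤h₁ (last∉between R (λ ()) h₁≢top b) λ { refl → ¬b b }

-- Mirror images

opposite-≤ : ∀ {m} {i j : Fin m} → i Fin.≤ j → opposite j Fin.≤ opposite i
opposite-≤ {m} {i} {j} i≤j rewrite Fin.opposite-prop i | Fin.opposite-prop j = ℕ.∸-monoʳ-≤ m (s≤s i≤j)

opposite-cancel-≤ : ∀ {m} {i j : Fin m} → opposite i Fin.≤ opposite j → j Fin.≤ i
opposite-cancel-≤ {i = i} {j} ī≤j̄ =
  subst₂ Fin._≤_ (Fin.opposite-involutive j) (Fin.opposite-involutive i) (opposite-≤ ī≤j̄)

-- Positions and values are both reversed: either reversal alone would put `n + 1` in the leftmost
-- position.
mirror : FramedPermutation n → FramedPermutation n
mirror P .perm      = Perm.reverse Perm.∘ₚ perm P Perm.∘ₚ Perm.reverse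
mirror P .leftmost  = trans (cong opposite (rightmost P)) (Fin.opposite-involutive 0F)
mirror P .rightmost = trans
  (cong (opposite ∘ elementAt P) (Fin.opposite-involutive 0F)) (cong opposite (leftmost P))

module _ (P : FramedPermutation n) (t u x : Fin (2 + n)) where

  between-mirror⁻ : Between (mirror P) t u x → Between P (opposite t) (opposite u) (opposite x)
  between-mirror⁻ = Sum.swap ∘ Sum.map flip-≤ flip-≤
    where
    flip-≤ : ∀ {a b c d : Fin (2 + n)} → opposite a Fin.≤ opposite b × opposite c Fin.≤ opposite d →
             d Fin.≤ c × b Fin.≤ a
    flip-≤ (p , q) = opposite-cancel-≤ q , opposite-cancel-≤ p

  between-mirror⁺ : Between P (opposite t) (opposite u) x → Between (mirror P) t u (opposite x)
  between-mirror⁺ b = Sum.swap (Sum.map flip-≤ flip-≤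
    (subst (Between P (opposite t) (opposite u)) (sym (Fin.opposite-involutive x)) b))
    where
    flip-≤ : ∀ {a b c d : Fin (2 + n)} → a Fin.≤ b × c Fin.≤ d →
             opposite d Fin.≤ opposite c × opposite b Fin.≤ opposite a
    flip-≤ (p , q) = opposite-≤ q , opposite-≤ p

-- `opposite` reverses the order, so the two ends trade roles. The permutations are arbitrary, in
-- order to cover both the passage to a mirror image and the way back.
spans-opposite : ∀ (P Q : FramedPermutation n) {t u t′ u′ lo hi} →
  (∀ x → Between P t u x → Between Q t′ u′ (opposite x)) →
  (∀ x → Between Q t′ u′ x → Between P t u (opposite x)) →
  Spans P t u lo hi → Spans Q t′ u′ (opposite hi) (opposite lo)
spans-opposite P Q {lo = lo} {hi} P⇒Q Q⇒P (spanning lo∈ hi∈ bounds) = spanning (P⇒Q _ hi∈) (P⇒Q _ lo∈) λ x b →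
  subst (opposite hi Fin.≤_) (Fin.opposite-involutive x) (opposite-≤ (proj₂ (bounds _ (Q⇒P x b)))) ,
  subst (Fin._≤ opposite lo) (Fin.opposite-involutive x) (opposite-≤ (proj₁ (bounds _ (Q⇒P x b))))

sameRange⇒spans : ∀ (P Q : FramedPermutation n) {t u} → SameRange P Q t u →
  Spans P t u (minBetween P t u) (maxBetween P t u) × Spans Q t u (minBetween P t u) (maxBetween P t u)
sameRange⇒spans P Q {t} {u} (sameRange mn mx) = spans P , subst₂ (Spans Q t u) (sym mn) (sym mx) (spans Q)
  where
  spans : ∀ R → Spans R t u (minBetween R t u) (maxBetween R t u)
  spans R = spanning (minBetween-∈ R t u) (maxBetween-∈ R t u) λ x b → minBetween-≤ R t u b , maxBetween-≥ R t u b

module _ (P Q : FramedPermutation n) {t u : Fin (2 + n)} where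

  sameRange-mirror⁺ : SameRange P Q (opposite t) (opposite u) → SameRange (mirror P) (mirror Q) t u
  sameRange-mirror⁺ same with sP , sQ ← sameRange⇒spans P Q same = spans⇒sameRange (mirror P) (mirror Q)
    (spans-opposite P (mirror P) (between-mirror⁺ P t u) (between-mirror⁻ P t u) sP)
    (spans-opposite Q (mirror Q) (between-mirror⁺ Q t u) (between-mirror⁻ Q t u) sQ)

  sameRange-mirror⁻ : SameRange (mirror P) (mirror Q) t u → SameRange P Q (opposite t) (opposite u)
  sameRange-mirror⁻ same with sP , sQ ← sameRange⇒spans (mirror P) (mirror Q) same = spans⇒sameRange P Q
    (spans-opposite (mirror P) P (between-mirror⁻ P t u) (between-mirror⁺ P t u) sP)
    (spans-opposite (mirror Q) Q (between-mirror⁻ Q t u) (between-mirror⁺ Q t u) sQ)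

sameRanges-mirror : ∀ (P Q : FramedPermutation n) → SameRanges k P Q → SameRanges k (mirror P) (mirror Q)
sameRanges-mirror {n} {k} P Q S {t} {u} t<u u≤t+k =
  sameRange-mirror⁺ P Q (sameRange-comm P Q (S ū<t̄ t̄≤ū+k))
  where
  ū<t̄ : opposite u Fin.< opposite t
  ū<t̄ = ℕ.≰⇒> (ℕ.<⇒≱ t<u ∘ opposite-cancel-≤)

  -- `u` and `opposite u` add up to `n + 1`, which turns `u ≤ t + k` into a bound on `opposite t`.
  m≤ : 2 + n ≤ suc (toℕ t) + (toℕ (opposite u) + k)
  m≤ = begin
    2 + n                                    ≡⟨ ℕ.m∸n+n≡m (Fin.toℕ<n u) ⟨
    2 + n ∸ suc (toℕ u) + suc (toℕ u)        ≡⟨ cong (_+ suc (toℕ u)) (Fin.opposite-prop u) ⟨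
    toℕ (opposite u) + suc (toℕ u)           ≤⟨ ℕ.+-monoʳ-≤ (toℕ (opposite u)) (s≤s u≤t+k) ⟩
    toℕ (opposite u) + (suc (toℕ t) + k)     ≡⟨ ℕ.+-assoc (toℕ (opposite u)) _ k ⟨
    toℕ (opposite u) + suc (toℕ t) + k       ≡⟨ cong (_+ k) (ℕ.+-comm (toℕ (opposite u)) _) ⟩
    suc (toℕ t) + toℕ (opposite u) + k       ≡⟨ ℕ.+-assoc (suc (toℕ t)) _ k ⟩
    suc (toℕ t) + (toℕ (opposite u) + k)     ∎
    where open ℕ.≤-Reasoning

  t̄≤ū+k : toℕ (opposite t) ≤ toℕ (opposite u) + k
  t̄≤ū+k = subst (_≤ toℕ (opposite u) + k) (sym (Fin.opposite-prop t)) (ℕ.m≤n+o⇒m∸n≤o (2 + n) (suc (toℕ t)) m≤)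

-- Transfers what is known about the largest elements of the mirror images to the smallest elements
-- of the permutations themselves.
sameRange-unmirror : ∀ (P Q : FramedPermutation n) t v →
  SameRange (mirror P) (mirror Q) t (opposite v) → SameRange P Q v (opposite t)
sameRange-unmirror P Q t v same = sameRange-comm P Q
  (subst (SameRange P Q (opposite t)) (Fin.opposite-involutive v) (sameRange-mirror⁻ P Q same))

-- From differences at most `n - 3` to all pairs

module _ {i : ℕ} where

  -- `t` and `opposite v` differ by `6 + i - (t + v)`, so these ten pairs are the ones whose
  -- difference exceeds `2 + i`.
  sameRange-far : ∀ (P Q : FramedPermutation (5 + i)) → SameRanges (2 + i) P Q →
    ∀ t v → toℕ t + toℕ v ≤ 3 → SameRange P Q t (opposite v)
  sameRange-far P Q S = far
    where
    -- The next three ranges are the same in every permutation.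
    spans-0-last : ∀ (R : FramedPermutation (5 + i)) → Spans R 0F (opposite 0F) 0F (opposite 0F)
    spans-0-last R = spanning (between-left R _ _) (between-right R _ _) λ x _ → z≤n , Fin.≤fromℕ x

    spans-0-h : ∀ (R : FramedPermutation (5 + i)) → Spans R 0F (opposite 1F) 0F (opposite 1F)
    spans-0-h R = spans-0 R (opposite 1F) h≢top ℕ.≤-refl λ x x≢ _ → ≤h x≢

    spans-1-h : ∀ (R : FramedPermutation (5 + i)) → Spans R 1F (opposite 1F) 1F (opposite 1F)
    spans-1-h R = spanning (between-left R _ _) (between-right R _ _) λ x b →
      ℕ.n≢0⇒n>0 (0∉between R (λ ()) (0≢h ∘ sym) b ∘ Fin.toℕ-injective) ,
      ≤h (last∉between R (λ ()) h≢top b)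

    S̄ : SameRanges (2 + i) (mirror P) (mirror Q)
    S̄ = sameRanges-mirror P Q S

    far : ∀ t v → toℕ t + toℕ v ≤ 3 → SameRange P Q t (opposite v)
    far 0F 0F _ = spans⇒sameRange P Q (spans-0-last P) (spans-0-last Q)
    far 0F 1F _ = spans⇒sameRange P Q (spans-0-h P) (spans-0-h Q)
    far 0F 2F _ = sameRange-0-h₁ P Q S
    far 0F 3F _ = sameRange-0-h₂ P Q S
    far 1F 0F _ = sameRange-unmirror P Q 0F 1F
      (spans⇒sameRange (mirror P) (mirror Q) (spans-0-h (mirror P)) (spans-0-h (mirror Q)))
    far 1F 1F _ = spans⇒sameRange P Q (spans-1-h P) (spans-1-h Q)
    far 1F 2F _ = sameRange-1-h₁ P Q S
    far 2F 0F _ = sameRange-unmirror P Q 0F 2F (sameRange-0-h₁ (mirror P) (mirror Q) S̄)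
    far 2F 1F _ = sameRange-unmirror P Q 1F 2F (sameRange-1-h₁ (mirror P) (mirror Q) S̄)
    far 3F 0F _ = sameRange-unmirror P Q 0F 3F (sameRange-0-h₂ (mirror P) (mirror Q) S̄)
    far 0F (suc (suc (suc (suc _)))) (s≤s (s≤s (s≤s ())))
    far 1F (suc (suc (suc _))) (s≤s (s≤s (s≤s ())))
    far 2F (suc (suc _)) (s≤s (s≤s (s≤s ())))
    far 3F (suc _) (s≤s (s≤s (s≤s ())))
    far (suc (suc (suc (suc _)))) _ (s≤s (s≤s (s≤s ())))

  sameRange-< : ∀ (P Q : FramedPermutation (5 + i)) → SameRanges (2 + i) P Q →
    ∀ {t u} → t Fin.< u → SameRange P Q t u
  sameRange-< P Q S {t} {u} t<u with toℕ u ℕ.≤? toℕ t + (2 + i)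
  ... | yes u≤ = S t<u u≤
  ... | no u≰  = subst (SameRange P Q t) (Fin.opposite-involutive u)
    (sameRange-far P Q S t (opposite u) t+ū≤3)
    where
    t+ū≤3 : toℕ t + toℕ (opposite u) ≤ 3
    t+ū≤3 = ℕ.+-cancelʳ-≤ (4 + i) _ _ (begin
      toℕ t + toℕ (opposite u) + (4 + i)    ≡⟨ cong (_+ (4 + i)) (ℕ.+-comm (toℕ t) _) ⟩
      toℕ (opposite u) + toℕ t + (4 + i)    ≡⟨ ℕ.+-assoc (toℕ (opposite u)) _ _ ⟩
      toℕ (opposite u) + (toℕ t + (4 + i))  ≡⟨ cong (toℕ (opposite u) +_)
                                                 (trans (ℕ.+-suc (toℕ t) _) (cong suc (ℕ.+-suc (toℕ t) _))) ⟩
      toℕ (opposite u) + (2 + (toℕ t + (2 + i))) ≤⟨ ℕ.+-monoʳ-≤ (toℕ (opposite u)) (s≤s (ℕ.≰⇒> u≰)) ⟩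
      toℕ (opposite u) + suc (toℕ u)        ≡⟨ cong (_+ suc (toℕ u)) (Fin.opposite-prop u) ⟩
      7 + i ∸ suc (toℕ u) + suc (toℕ u)     ≡⟨ ℕ.m∸n+n≡m (Fin.toℕ<n u) ⟩
      3 + (4 + i)                           ∎)
      where open ℕ.≤-Reasoning

  sameRanges⇒≈ : ∀ (P Q : FramedPermutation (5 + i)) → SameRanges (2 + i) P Q → perm P Perm.≈ perm Q
  sameRanges⇒≈ P Q S = sameOrder⇒≈ P Q (sameRange⇒sameOrder P Q same)
    where
    same : ∀ t u → t ≢ u → SameRange P Q t u
    same t u t≢u with Fin.<-cmp t u
    ... | tri< t<u _ _ = sameRange-< P Q S t<u
    ... | tri≈ _ t≡u _ = contradiction t≡u t≢u
    ... | tri> _ _ u<t = sameRange-comm P Q (sameRange-< P Q S u<t)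

-- Decidability

insert-self : ∀ {m} (i j : Fin (suc m)) (π : Permutation′ m) → Perm.insert i j π ⟨$⟩ʳ i ≡ j
insert-self i j π with i Fin.≟ i
... | yes _   = refl
... | no i≢i  = contradiction refl i≢i

insert-cong : ∀ {m} (i j : Fin (suc m)) (π ρ : Permutation′ m) → π Perm.≈ ρ →
  Perm.insert i j π Perm.≈ Perm.insert i j ρ
insert-cong i j π ρ π≈ρ p with i Fin.≟ p
... | yes _ = refl
... | no _  = cong (Fin.punchIn j) (π≈ρ _)

-- Stated up to pointwise equality, the only sense in which `encode` recovers a permutation.
insert-remove′ : ∀ {m} i {j} (π : Permutation′ (suc m)) ρ → π ⟨$⟩ʳ i ≡ j → ρ Perm.≈ Perm.remove i π →
  Perm.insert i j ρ Perm.≈ π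
insert-remove′ i π ρ refl ρ≈ p =
  trans (insert-cong i _ ρ (Perm.remove i π) ρ≈ p) (Perm.insert-remove i π p)

-- The Lehmer code of a permutation: the images of the first elements, each
-- numbered among the values still available.
Code : ℕ → Set
Code zero    = ⊤
Code (suc m) = Fin (suc m) × Code m

decode : ∀ {m} → Code m → Permutation′ m
decode {zero}  _       = Perm.id
decode {suc m} (j , c) = Perm.insert 0F j (decode c)

encode : ∀ {m} (π : Permutation′ m) → ∃[ c ] decode c Perm.≈ π
encode {zero}  π = tt , λ ()
encode {suc m} π with c , eq ← encode (Perm.remove 0F π) =
  (π ⟨$⟩ʳ 0F , c) , insert-remove′ 0F π (decode c) refl eq

allCodes? : ∀ {m} {R : Code m → Set} → (∀ c → Dec (R c)) → Dec (∀ c → R c)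
allCodes? {zero}  R? = map′ (λ r _ → r) (λ f → f tt) (R? tt)
allCodes? {suc m} R? = map′ (λ f (j , c) → f j c) (λ f j c → f (j , c))
  (Fin.all? λ j → allCodes? λ c → R? (j , c))

-- The code covers only the elements between 0 and `n + 1`, so that the search runs over `n!` cases.
frame : Code n → FramedPermutation n
frame {n} c .perm      = Perm.lift₀ (Perm.insert (fromℕ n) (fromℕ n) (decode c))
frame     c .leftmost  = refl
frame {n} c .rightmost = cong suc (insert-self (fromℕ n) (fromℕ n) (decode c))

frame-surjective : ∀ (P : FramedPermutation n) → ∃[ c ] perm (frame c) Perm.≈ perm P
frame-surjective {n} P = proj₁ code , λ p → trans
  (Perm.lift₀-cong (Perm.insert (fromℕ n) (fromℕ n) (decode (proj₁ code))) π
    (insert-remove′ (fromℕ n) π (decode (proj₁ code)) π-last (proj₂ code)) p)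
  (Perm.lift₀-remove (perm P) (leftmost P) p)
  where
  π : Permutation′ (suc n)
  π = Perm.remove 0F (perm P)
  code : ∃[ c ] decode c Perm.≈ Perm.remove (fromℕ n) π
  code = encode (Perm.remove (fromℕ n) π)
  π-last : π ⟨$⟩ʳ fromℕ n ≡ fromℕ n
  π-last = Fin.suc-injective (trans
    (Perm.lift₀-remove (perm P) (leftmost P) (fromℕ (suc n))) (rightmost P))

-- Invariance under pointwise equality, and directed profiles

≈⇒position : ∀ (P P′ : FramedPermutation n) → perm P Perm.≈ perm P′ → ∀ x → position P x ≡ position P′ x
≈⇒position P P′ eq x =
  sym (position-unique P′ (trans (sym (eq (position P x))) (Perm.inverseʳ (perm P))))

≈⇒sameRange : ∀ (P P′ : FramedPermutation n) → perm P Perm.≈ perm P′ → ∀ t u → SameRange P P′ t u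
≈⇒sameRange {n} P P′ eq t u = covers⇒sameRange P P′ t u
  (covers P P′ (≈⇒position P P′ eq)) (covers P′ P (sym ∘ ≈⇒position P P′ eq))
  where
  covers : ∀ (R R′ : FramedPermutation n) → (∀ x → position R x ≡ position R′ x) → Covers R R′ t u
  covers R R′ same x b = (x , b′ , ℕ.≤-refl) , (x , b′ , ℕ.≤-refl)
    where
    b′ : Between R t u x
    b′ rewrite same t | same u | same x = b

sameRange-trans : ∀ {P Q R : FramedPermutation n} {t u} →
  SameRange P Q t u → SameRange Q R t u → SameRange P R t u
sameRange-trans (sameRange mn mx) (sameRange mn′ mx′) = sameRange (trans mn mn′) (trans mx mx′)

SameSides : ℕ → (P Q : FramedPermutation n) → Set
SameSides k P Q = ∀ {t u} → t Fin.< u → toℕ u ≤ toℕ t + k → side P t u ≡ side Q t u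

≈⇒side : ∀ (P P′ : FramedPermutation n) → perm P Perm.≈ perm P′ → ∀ t u → side P t u ≡ side P′ t u
≈⇒side P P′ eq t u rewrite ≈⇒position P P′ eq t | ≈⇒position P P′ eq u = refl

directedProfile⇒ : ∀ (P Q : FramedPermutation n) → DirectedProfile k P ≐ DirectedProfile k Q →
  SameRanges k P Q × SameSides k P Q
directedProfile⇒ P Q (⊆ , ⊇) =
  profile⇒sameRanges P Q
    ((λ {c} p → proj₁ (⊆ {c , side P (Constraint.t c) (Constraint.u c)} (p , refl))) ,
     (λ {c} q → proj₁ (⊇ {c , side Q (Constraint.t c) (Constraint.u c)} (q , refl)))) ,
  λ {t} {u} t<u u≤t+k → proj₂ (⊆ {⟨ t , u ,[ minBetween P t u , maxBetween P t u ]⟩ , side P t u}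
    (constraint∈profile P t<u u≤t+k , refl))

⇒directedProfile : ∀ (P Q : FramedPermutation n) → SameRanges k P Q → SameSides k P Q →
  DirectedProfile k P ≐ DirectedProfile k Q
⇒directedProfile {n} {k} P Q S D =
  (λ {c} → half P Q S D {c}) , (λ {c} → half Q P (sameRanges-sym P Q S) (λ t<u u≤ → sym (D t<u u≤)) {c})
  where
  half : ∀ (P Q : FramedPermutation n) → SameRanges k P Q → SameSides k P Q →
    ∀ {c} → DirectedProfile k P c → DirectedProfile k Q c
  half P Q S D {⟨ t , u ,[ _ , _ ]⟩ , _} (p@(i , 1≤i , i≤k , u≡t+i , _) , s) =
    sameRanges⇒profile⊆ P Q S p ,
    trans s (D (subst (toℕ t <_) (sym u≡t+i) (ℕ.m<m+n (toℕ t) 1≤i))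
               (subst (_≤ toℕ t + _) (sym u≡t+i) (ℕ.+-monoʳ-≤ (toℕ t) i≤k)))

reconstructing⇒directed : Reconstructing n k → DirectedReconstructing n k
reconstructing⇒directed R P Q eq =
  R P Q (sameRanges⇒profile P Q (proj₁ (directedProfile⇒ P Q eq)))

-- Comparison of all pairs of permutations

sameRange? : ∀ (P Q : FramedPermutation n) t u → Dec (SameRange P Q t u)
sameRange? P Q t u = map′ (λ (mn , mx) → sameRange mn mx) (λ (sameRange mn mx) → mn , mx)
  ((minBetween P t u Fin.≟ minBetween Q t u) ×-dec (maxBetween P t u Fin.≟ maxBetween Q t u))

_≟ˢ_ : (s s′ : Side) → Dec (s ≡ s′)
left  ≟ˢ left  = yes refl
left  ≟ˢ right = no λ ()
right ≟ˢ left  = no λ ()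
right ≟ˢ right = yes refl

allClose? : ∀ {m} k {R : Fin m → Fin m → Set} → (∀ t u → Dec (R t u)) →
  Dec (∀ {t u} → t Fin.< u → toℕ u ≤ toℕ t + k → R t u)
allClose? k R? = map′ (λ f {t} {u} → f t u) (λ f t u → f {t} {u})
  (Fin.all? λ t → Fin.all? λ u → (t Fin.<? u) →-dec ((toℕ u ℕ.≤? toℕ t + k) →-dec R? t u))

Determines : (n : ℕ) → (FramedPermutation n → FramedPermutation n → Set) → Set
Determines n _~_ = ∀ P Q → P ~ Q → perm P Perm.≈ perm Q

-- A permutation is only pointwise equal to the frame of its code; `resp` carries the relation over
-- to that frame, which leaves a quantification over codes.
determines? : ∀ {_~_ : FramedPermutation n → FramedPermutation n → Set} →
  (∀ {P P′ Q Q′} → perm P Perm.≈ perm P′ → perm Q Perm.≈ perm Q′ → P ~ Q → P′ ~ Q′) →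
  (∀ P Q → Dec (P ~ Q)) → Dec (Determines n _~_)
determines? {n} {_~_} resp _~?_ = map′ to (λ f c c′ → f (frame c) (frame c′))
  (allCodes? λ c → allCodes? λ c′ → (frame c ~? frame c′) →-dec
    Fin.all? λ p → elementAt (frame c) p Fin.≟ elementAt (frame c′) p)
  where
  to : (∀ c c′ → frame c ~ frame c′ → perm (frame c) Perm.≈ perm (frame c′)) → Determines n _~_
  to f P Q P~Q p = trans (sym (c≈P p)) (trans
    (f c c′ (resp {P} {frame c} {Q} {frame c′} (sym ∘ c≈P) (sym ∘ c′≈Q) P~Q) p) (c′≈Q p))
    where
    c    = proj₁ (frame-surjective P)
    c≈P  = proj₂ (frame-surjective P)
    c′   = proj₁ (frame-surjective Q)
    c′≈Q = proj₂ (frame-surjective Q)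

sameRanges-resp : ∀ {P P′ Q Q′ : FramedPermutation n} → perm P Perm.≈ perm P′ → perm Q Perm.≈ perm Q′ →
  SameRanges k P Q → SameRanges k P′ Q′
sameRanges-resp {P = P} {P′} {Q} {Q′} P≈ Q≈ S {t} {u} t<u u≤ =
  sameRange-trans (sameRange-sym (≈⇒sameRange P P′ P≈ t u))
    (sameRange-trans (S t<u u≤) (≈⇒sameRange Q Q′ Q≈ t u))

sameSides-resp : ∀ {P P′ Q Q′ : FramedPermutation n} → perm P Perm.≈ perm P′ → perm Q Perm.≈ perm Q′ →
  SameSides k P Q → SameSides k P′ Q′
sameSides-resp {P = P} {P′} {Q} {Q′} P≈ Q≈ D {t} {u} t<u u≤ =
  trans (sym (≈⇒side P P′ P≈ t u)) (trans (D t<u u≤) (≈⇒side Q Q′ Q≈ t u))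

rangesDetermine? : ∀ n k → Dec (Determines n (SameRanges k))
rangesDetermine? n k = determines?
  (λ {P} {P′} {Q} {Q′} → sameRanges-resp {P = P} {P′} {Q} {Q′}) (λ P Q → allClose? k (sameRange? P Q))

directedReconstructing? : ∀ n k → Dec (DirectedReconstructing n k)
directedReconstructing? n k = map′
  (λ f P Q eq → f P Q (directedProfile⇒ P Q eq))
  (λ R P Q (S , D) → R P Q (⇒directedProfile P Q S D))
  (determines? {_~_ = λ P Q → SameRanges k P Q × SameSides k P Q}
    (λ {P} {P′} {Q} {Q′} P≈ Q≈ (S , D) → (λ {t} {u} → sameRanges-resp {P = P} {P′} {Q} {Q′} P≈ Q≈ S {t} {u}) ,
      (λ {t} {u} → sameSides-resp {P = P} {P′} {Q} {Q′} P≈ Q≈ D {t} {u}))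
    (λ P Q → allClose? k (sameRange? P Q) ×-dec allClose? k (λ t u → side P t u ≟ˢ side Q t u)))

determines⇒reconstructing : Determines n (SameRanges k) → Reconstructing n k
determines⇒reconstructing f P Q eq = f P Q (profile⇒sameRanges P Q eq)

reconstructing-1 : ∀ n → n ≤ 4 → Reconstructing n 1
reconstructing-1 0 _ = determines⇒reconstructing (from-yes (rangesDetermine? 0 1))
reconstructing-1 1 _ = determines⇒reconstructing (from-yes (rangesDetermine? 1 1))
reconstructing-1 2 _ = determines⇒reconstructing (from-yes (rangesDetermine? 2 1))
reconstructing-1 3 _ = determines⇒reconstructing (from-yes (rangesDetermine? 3 1))
reconstructing-1 4 _ = determines⇒reconstructing (from-yes (rangesDetermine? 4 1))
reconstructing-1 (suc (suc (suc (suc (suc _))))) (s≤s (s≤s (s≤s (s≤s ()))))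

reconstructing-n∸3 : ∀ n → Reconstructing n (1 ⊔ (n ∸ 3))
reconstructing-n∸3 (suc (suc (suc (suc (suc i))))) = determines⇒reconstructing sameRanges⇒≈
reconstructing-n∸3 0 = reconstructing-1 0 z≤n
reconstructing-n∸3 1 = reconstructing-1 1 (s≤s z≤n)
reconstructing-n∸3 2 = reconstructing-1 2 (s≤s (s≤s z≤n))
reconstructing-n∸3 3 = reconstructing-1 3 (s≤s (s≤s (s≤s z≤n)))
reconstructing-n∸3 4 = reconstructing-1 4 (s≤s (s≤s (s≤s (s≤s z≤n))))

-- Existence of a minimum

leastFrom : ∀ {R : ℕ → Set} → (∀ k → Dec (R k)) → ∀ d {j m} → 1 ≤ j → j + d ≡ m → R m →
  (∀ k → 1 ≤ k → k < j → ¬ R k) → ∃[ k ] IsMinimumIn[1, m ] R k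
leastFrom R? d {j} 1≤j refl Rm below with R? j
... | yes Rj = j , record
  { positive = 1≤j ; bounded = ℕ.m≤m+n j d ; holds = Rj
  ; minimal = λ k 1≤k _ Rk → ℕ.≮⇒≥ λ k<j → below k 1≤k k<j Rk }
-- No step is left, so `j` is `m`, where `R` holds by assumption.
leastFrom {R} R? zero {j} 1≤j refl Rm below | no ¬Rj = contradiction (subst R (ℕ.+-identityʳ j) Rm) ¬Rj
leastFrom {R} R? (suc d) {j} 1≤j refl Rm below | no ¬Rj =
  leastFrom R? d {suc j} (s≤s z≤n) (sym (ℕ.+-suc j d)) Rm λ k 1≤k k<1+j Rk →
    Sum.[ (λ k<j → below k 1≤k k<j Rk) , (λ k≡j → ¬Rj (subst R k≡j Rk)) ] (ℕ.m≤n⇒m<n∨m≡n (ℕ.≤-pred k<1+j))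

-- `k_d(n)` is only bounded, not computed, so its existence has to come from a search on a decidable
-- property.
least : ∀ {R : ℕ → Set} → (∀ k → Dec (R k)) → ∀ {m} → R (suc m) → ∃[ k ] IsMinimumIn[1, suc m ] R k
least R? {m} Rm = leastFrom R? m {1} (s≤s z≤n) refl Rm λ k 1≤k k<1 → contradiction 1≤k (ℕ.<⇒≱ k<1)

-- More constraints leave fewer candidates. This provides the success at `n + 1` that the search
-- requires.
directedReconstructing-mono : ∀ {k k′} → k ≤ k′ → DirectedReconstructing n k → DirectedReconstructing n k′
directedReconstructing-mono k≤k′ R P Q eq with S , D ← directedProfile⇒ P Q eq =
  R P Q (⇒directedProfile P Q (λ {t} t<u u≤ → S t<u (ℕ.≤-trans u≤ (ℕ.+-monoʳ-≤ (toℕ t) k≤k′)))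
                              (λ {t} t<u u≤ → D t<u (ℕ.≤-trans u≤ (ℕ.+-monoʳ-≤ (toℕ t) k≤k′))))

-- Lower bounds

OneOf : ∀ {m} (a b x : Fin m) → Set
OneOf a b x = x ≡ a ⊎ x ≡ b

oneOf? : ∀ {m} (a b x : Fin m) → Dec (OneOf a b x)
oneOf? a b x = (x Fin.≟ a) ⊎-dec (x Fin.≟ b)

-- The premise excludes the comparisons inside `{a, b}`, the only ones affected by exchanging `a`
-- and `b` in adjacent positions.
KeepsOrder : (P Q : FramedPermutation n) (a b : Fin (2 + n)) → Set
KeepsOrder P Q a b = ∀ {x y} → (OneOf a b x → ¬ OneOf a b y) → pos P x ≤ pos P y → pos Q x ≤ pos Q y

module _ (P Q : FramedPermutation n) {a b : Fin (2 + n)}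
         (P⇒Q : KeepsOrder P Q a b) (Q⇒P : KeepsOrder Q P a b) where

  private
    between-keep : ∀ {R R′ : FramedPermutation n} → KeepsOrder R R′ a b → ∀ {t u x} →
      (OneOf a b x → ¬ OneOf a b t) → (OneOf a b x → ¬ OneOf a b u) → Between R t u x → Between R′ t u x
    between-keep keep xt xu = Sum.map
      (λ (t≤x , x≤u) → keep (λ t∈ x∈ → xt x∈ t∈) t≤x , keep xu x≤u)
      (λ (u≤x , x≤t) → keep (λ u∈ x∈ → xu x∈ u∈) u≤x , keep xt x≤t)

  -- Membership in the interval then involves no comparison of `a` with `b`, so the two intervals
  -- have the same elements.
  sameRange-neither : ∀ {t u} → ¬ OneOf a b t → ¬ OneOf a b u → SameRange P Q t u
  sameRange-neither {t} {u} t∉ u∉ = covers⇒sameRange P Q t u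
    (covers {P} {Q} Q⇒P) (covers {Q} {P} P⇒Q)
    where
    covers : ∀ {R R′} → KeepsOrder R′ R a b → Covers R R′ t u
    covers {R} {R′} keep x bt = (x , bt′ , ℕ.≤-refl) , (x , bt′ , ℕ.≤-refl)
      where
      bt′ : Between R t u x
      bt′ = between-keep {R′} {R} keep (λ _ → t∉) (λ _ → u∉) bt

  -- The intervals can differ only by `a` and `b`, and elements of both intervals that enclose these
  -- two values hide the difference.
  sameRange-bounded : ∀ {t u} lo hi →
    lo Fin.≤ a → lo Fin.≤ b → a Fin.≤ hi → b Fin.≤ hi →
    Between P t u lo → Between Q t u lo → Between P t u hi → Between Q t u hi → SameRange P Q t u
  sameRange-bounded {t} {u} lo hi lo≤a lo≤b a≤hi b≤hi loP loQ hiP hiQ = covers⇒sameRange P Q t u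
    (covers {P} {Q} Q⇒P loP hiP) (covers {Q} {P} P⇒Q loQ hiQ)
    where
    covers : ∀ {R R′} → KeepsOrder R′ R a b → Between R t u lo → Between R t u hi → Covers R R′ t u
    covers {R} {R′} keep lo∈ hi∈ x bt with oneOf? a b x
    ... | yes (inj₁ refl) = (lo , lo∈ , lo≤a) , (hi , hi∈ , a≤hi)
    ... | yes (inj₂ refl) = (lo , lo∈ , lo≤b) , (hi , hi∈ , b≤hi)
    ... | no x∉ = (x , bt′ , ℕ.≤-refl) , (x , bt′ , ℕ.≤-refl)
      where
      bt′ : Between R t u x
      bt′ = between-keep {R′} {R} keep (λ x∈ → contradiction x∈ x∉) (λ x∈ → contradiction x∈ x∉) bt

  sameSide : ∀ {t u} → t ≢ u → (OneOf a b t → ¬ OneOf a b u) → side P t u ≡ side Q t u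
  sameSide {t} {u} t≢u tu with before-or-after P t≢u
  ... | inj₁ t◁u = trans (side-left P t◁u)
    (sym (side-left Q (ℕ.≤∧≢⇒< (P⇒Q tu (ℕ.<⇒≤ t◁u)) (t≢u ∘ pos-injective Q))))
    where
    side-left : ∀ R → pos R t < pos R u → side R t u ≡ left
    side-left R t◁u rewrite dec-true (position R t Fin.<? position R u) t◁u = refl
  ... | inj₂ u◁t = trans (side-right P (ℕ.<⇒≤ u◁t))
    (sym (side-right Q (P⇒Q (λ u∈ t∈ → tu t∈ u∈) (ℕ.<⇒≤ u◁t))))
    where
    side-right : ∀ R → pos R u ≤ pos R t → side R t u ≡ right
    side-right R u≤t rewrite dec-false (position R t Fin.<? position R u) (ℕ.≤⇒≯ u≤t) = refl

-- Exchange of the first two elements after 0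

module _ {j : ℕ} where

  transpose-mono : ∀ {p q : Fin (4 + j)} → (OneOf 1F 2F p → ¬ OneOf 1F 2F q) → p Fin.≤ q →
    Perm.transpose 1F 2F ⟨$⟩ˡ p Fin.≤ Perm.transpose 1F 2F ⟨$⟩ˡ q
  transpose-mono {0F} _ _ = z≤n
  transpose-mono {1F} {1F} pq _ = contradiction (inj₁ refl) (pq (inj₁ refl))
  transpose-mono {1F} {2F} pq _ = contradiction (inj₂ refl) (pq (inj₁ refl))
  transpose-mono {1F} {suc (suc (suc q))} _ _ = s≤s (s≤s z≤n)
  transpose-mono {2F} {1F} pq _ = contradiction (inj₁ refl) (pq (inj₂ refl))
  transpose-mono {2F} {2F} pq _ = contradiction (inj₂ refl) (pq (inj₂ refl))
  transpose-mono {2F} {suc (suc (suc q))} _ _ = s≤s z≤n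
  transpose-mono {suc (suc (suc p))} {suc (suc (suc q))} _ p≤q = p≤q
  transpose-mono {suc (suc (suc p))} {1F} _ (s≤s ())
  transpose-mono {suc (suc (suc p))} {2F} _ (s≤s (s≤s ()))

  transpose-mono⁻ : ∀ {p q : Fin (4 + j)} → (OneOf 1F 2F p → ¬ OneOf 1F 2F q) →
    Perm.transpose 1F 2F ⟨$⟩ˡ p Fin.≤ Perm.transpose 1F 2F ⟨$⟩ˡ q → p Fin.≤ q
  transpose-mono⁻ {0F} _ _ = z≤n
  transpose-mono⁻ {1F} {1F} pq _ = contradiction (inj₁ refl) (pq (inj₁ refl))
  transpose-mono⁻ {1F} {2F} pq _ = contradiction (inj₂ refl) (pq (inj₁ refl))
  transpose-mono⁻ {1F} {suc (suc (suc q))} _ _ = s≤s z≤n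
  transpose-mono⁻ {2F} {1F} pq _ = contradiction (inj₁ refl) (pq (inj₂ refl))
  transpose-mono⁻ {2F} {2F} pq _ = contradiction (inj₂ refl) (pq (inj₂ refl))
  transpose-mono⁻ {2F} {suc (suc (suc q))} _ _ = s≤s (s≤s z≤n)
  transpose-mono⁻ {suc (suc (suc p))} {suc (suc (suc q))} _ p≤q = p≤q
  transpose-mono⁻ {suc (suc (suc p))} {1F} _ (s≤s (s≤s ()))
  transpose-mono⁻ {suc (suc (suc p))} {2F} _ (s≤s ())

  -- The transposition is applied first, hence to positions and not to values.
  swapFirst : FramedPermutation (2 + j) → FramedPermutation (2 + j)
  swapFirst P .perm      = Perm.transpose 1F 2F Perm.∘ₚ perm P
  swapFirst P .leftmost  = leftmost P
  swapFirst P .rightmost = rightmost P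

  module _ (P : FramedPermutation (2 + j)) where

    private
      a b : Fin (4 + j)
      a = elementAt P 1F
      b = elementAt P 2F

      at-first : ∀ {x} → OneOf 1F 2F (position P x) → OneOf a b x
      at-first {x} = Sum.map at at
        where
        at : ∀ {p} → position P x ≡ p → x ≡ elementAt P p
        at refl = sym (Perm.inverseʳ (perm P))

    swapFirst-keepsOrder : KeepsOrder P (swapFirst P) a b
    swapFirst-keepsOrder xy = transpose-mono (λ p q → xy (at-first p) (at-first q))

    swapFirst-keepsOrder⁻ : KeepsOrder (swapFirst P) P a b
    swapFirst-keepsOrder⁻ xy = transpose-mono⁻ (λ p q → xy (at-first p) (at-first q))

    swapFirst-≉ : ¬ (perm P Perm.≈ perm (swapFirst P))
    swapFirst-≉ eq with () ← trans (sym (position-unique P refl)) (position-unique P (sym (eq 1F)))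

-- Effect of the exchange on a word 0 a b 1 d ...

module _ {j : ℕ} (P : FramedPermutation (3 + j))
  (1-third : elementAt P 3F ≡ 1F)
  (1<a : 1 < toℕ (elementAt P 1F))
  (a<b : elementAt P 1F Fin.< elementAt P 2F)
  (b≤d : elementAt P 2F Fin.≤ elementAt P 4F) where

  private
    Q : FramedPermutation (3 + j)
    Q = swapFirst P

    a b d : Fin (5 + j)
    a = elementAt P 1F
    b = elementAt P 2F
    d = elementAt P 4F

    1≤a : 1 ≤ toℕ a
    1≤a = ℕ.<⇒≤ 1<a

    1≤b : 1 ≤ toℕ b
    1≤b = ℕ.<⇒≤ (ℕ.<-trans 1<a a<b)

    a≤d : a Fin.≤ d
    a≤d = ℕ.≤-trans (ℕ.<⇒≤ a<b) b≤d

    beyond : ∀ {w} → w ≢ 0F → w ≢ 1F → ¬ OneOf a b w → ∃[ p ] elementAt P (suc (suc (suc (suc p)))) ≡ w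
    beyond {w} w≢0 w≢1 w∉ = go (position P w) (Perm.inverseʳ (perm P))
      where
      go : ∀ p → elementAt P p ≡ w → ∃[ p ] elementAt P (suc (suc (suc (suc p)))) ≡ w
      go 0F eq = contradiction (trans (sym eq) (leftmost P)) w≢0
      go 1F eq = contradiction (inj₁ (sym eq)) w∉
      go 2F eq = contradiction (inj₂ (sym eq)) w∉
      go 3F eq = contradiction (trans (sym eq) 1-third) w≢1
      go (suc (suc (suc (suc p)))) eq = p , eq

    pos-oneOf : ∀ {v} → OneOf a b v → pos P v ≤ 2 × pos Q v ≤ 2
    pos-oneOf (inj₁ refl) rewrite position-unique P {1F} refl = s≤s z≤n , s≤s (s≤s z≤n)
    pos-oneOf (inj₂ refl) rewrite position-unique P {2F} refl = s≤s (s≤s z≤n) , s≤s z≤n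

    -- On the way from `a` or `b` to an element beyond 1, the interval meets 1 and `d`, which
    -- enclose both exchanged values.
    sameRange-wide : ∀ {v w} → OneOf a b v → w ≢ 0F → w ≢ 1F → ¬ OneOf a b w → SameRange P Q v w
    sameRange-wide {v} {w} v∈ w≢0 w≢1 w∉ with beyond w≢0 w≢1 w∉
    ... | p , refl with v≤P , v≤Q ← pos-oneOf v∈ =
      sameRange-bounded P Q (swapFirst-keepsOrder P) (swapFirst-keepsOrder⁻ P) 1F d 1≤a 1≤b a≤d b≤d
        (on-the-way P v≤P 1P (s≤s (s≤s z≤n)) (s≤s (s≤s (s≤s z≤n))) wP)
        (on-the-way Q v≤Q 1Q (s≤s (s≤s z≤n)) (s≤s (s≤s (s≤s z≤n))) wQ)
        (on-the-way P v≤P dP (s≤s (s≤s z≤n)) ℕ.≤-refl wP)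
        (on-the-way Q v≤Q dQ (s≤s (s≤s z≤n)) ℕ.≤-refl wQ)
      where
      on-the-way : ∀ R {x r} → pos R v ≤ 2 → pos R x ≡ r → 2 ≤ r → r ≤ 4 → pos R w ≡ 4 + toℕ p →
        Between R v w x
      on-the-way R v≤2 refl 2≤x x≤4 w≡ =
        inj₁ (ℕ.≤-trans v≤2 2≤x , subst (_ ≤_) (sym w≡) (ℕ.≤-trans x≤4 (ℕ.m≤m+n 4 (toℕ p))))

      1P : pos P 1F ≡ 3
      1P = cong toℕ (position-unique P {3F} 1-third)
      1Q : pos Q 1F ≡ 3
      1Q = cong toℕ (position-unique Q {3F} 1-third)
      dP : pos P d ≡ 4
      dP = cong toℕ (position-unique P {4F} refl)
      dQ : pos Q d ≡ 4
      dQ = cong toℕ (position-unique Q {4F} refl)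
      wP : pos P w ≡ 4 + toℕ p
      wP = cong toℕ (position-unique P {suc (suc (suc (suc p)))} refl)
      wQ : pos Q w ≡ 4 + toℕ p
      wQ = cong toℕ (position-unique Q {suc (suc (suc (suc p)))} refl)

    sameRange-ends : ∀ {t u} → t Fin.≤ a → t Fin.≤ b → a Fin.≤ u → b Fin.≤ u → SameRange P Q t u
    sameRange-ends {t} {u} ta tb au bu =
      sameRange-bounded P Q (swapFirst-keepsOrder P) (swapFirst-keepsOrder⁻ P) t u ta tb au bu
        (between-left P t u) (between-left Q t u) (between-right P t u) (between-right Q t u)

  -- Only the ranges from 0 and from 1 to a tell whether b precedes a.
  swapFirst-sameRange : ∀ {t u} → t Fin.< u → ¬ (toℕ t ≤ 1 × u ≡ a) → SameRange P Q t u
  swapFirst-sameRange {t} {u} t<u excl with oneOf? a b t | oneOf? a b u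
  ... | no t∉ | no u∉ =
    sameRange-neither P Q (swapFirst-keepsOrder P) (swapFirst-keepsOrder⁻ P) t∉ u∉
  ... | yes (inj₁ refl) | yes (inj₁ refl) = contradiction t<u (ℕ.<-irrefl refl)
  ... | yes (inj₁ refl) | yes (inj₂ refl) = sameRange-ends ℕ.≤-refl (ℕ.<⇒≤ a<b) (ℕ.<⇒≤ a<b) ℕ.≤-refl
  ... | yes (inj₂ refl) | yes (inj₁ refl) = contradiction t<u (ℕ.<-asym a<b)
  ... | yes (inj₂ refl) | yes (inj₂ refl) = contradiction t<u (ℕ.<-irrefl refl)
  ... | yes t∈ | no u∉ = sameRange-wide t∈
    (λ { refl → ℕ.<⇒≱ t<u z≤n }) (λ { refl → ℕ.<⇒≱ t<u (1≤ t∈) }) u∉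
    where
    1≤ : ∀ {v} → OneOf a b v → 1 ≤ toℕ v
    1≤ (inj₁ refl) = 1≤a
    1≤ (inj₂ refl) = 1≤b
  ... | no t∉ | yes (inj₁ refl) = sameRange-comm P Q (sameRange-wide (inj₁ refl)
    (λ { refl → excl (z≤n , refl) }) (λ { refl → excl (s≤s z≤n , refl) }) t∉)
  -- From 0 or 1 to `b`, the ends already enclose `a` and `b`; this fails for `a`, which is smaller
  -- than `b`.
  ... | no t∉ | yes (inj₂ refl) with toℕ t ℕ.≤? 1
  ...   | yes t≤1 = sameRange-ends (ℕ.≤-trans t≤1 1≤a) (ℕ.≤-trans t≤1 1≤b) (ℕ.<⇒≤ a<b) ℕ.≤-refl
  ...   | no t≰1  = sameRange-comm P Q (sameRange-wide (inj₂ refl)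
    (λ { refl → t≰1 z≤n }) (λ { refl → t≰1 (s≤s z≤n) }) t∉)

  swapFirst-sameSide : ∀ {t u} → t Fin.< u → ¬ (t ≡ a × u ≡ b) → side P t u ≡ side Q t u
  swapFirst-sameSide {t} {u} t<u excl =
    sameSide P Q (swapFirst-keepsOrder P) (swapFirst-keepsOrder⁻ P) (λ { refl → ℕ.<-irrefl refl t<u }) apart
    where
    apart : OneOf a b t → ¬ OneOf a b u
    apart (inj₁ refl) (inj₁ refl) = ℕ.<-irrefl refl t<u
    apart (inj₁ refl) (inj₂ refl) = excl (refl , refl)
    apart (inj₂ refl) (inj₁ refl) = ℕ.<-asym a<b t<u
    apart (inj₂ refl) (inj₂ refl) = ℕ.<-irrefl refl t<u

  -- The exceptional pairs, from 0 and from 1 to `a`, have differences at least `a - 1`, out of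
  -- reach of `k`.
  swapFirst-sameRanges : 1 + k < toℕ a → SameRanges k P Q
  swapFirst-sameRanges {k} k< {t} {u} t<u u≤ = swapFirst-sameRange t<u λ { (t≤1 , refl) →
    ℕ.<⇒≱ k< (ℕ.≤-trans u≤ (ℕ.+-monoˡ-≤ k t≤1)) }

  swapFirst-sameSides : toℕ a + k < toℕ b → SameSides k P Q
  swapFirst-sameSides k< t<u u≤ = swapFirst-sameSide t<u λ { (refl , refl) → ℕ.<⇒≱ k< u≤ }

-- The words of the lower bounds

toℕ-punchIn-≥ : ∀ {m} (i : Fin (suc m)) (j : Fin m) → toℕ i ≤ toℕ j → toℕ (Fin.punchIn i j) ≡ suc (toℕ j)
toℕ-punchIn-≥ zero    j       _       = refl
toℕ-punchIn-≥ (suc i) (suc j) (s≤s p) = cong suc (toℕ-punchIn-≥ i j p)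

module _ {i : ℕ} (c : Fin (5 + i)) (c≤ : toℕ c ≤ 1 + i) where

  private
    -- The rank of `n - 1` among the values still available after 0 and `c + 2`; `d₄` is likewise
    -- the rank of `n` once 1 and `n - 1` are used too. Each `inject₁` accounts for one larger value
    -- still available.
    b₂ : Fin (5 + i)
    b₂ = Fin.inject₁ (Fin.inject₁ (fromℕ (2 + i)))

    toℕ-b₂ : toℕ b₂ ≡ 2 + i
    toℕ-b₂ = trans (Fin.toℕ-inject₁ _) (trans (Fin.toℕ-inject₁ _) (Fin.toℕ-fromℕ (2 + i)))

    d₄ : Fin (3 + i)
    d₄ = Fin.inject₁ (fromℕ (1 + i))

    toℕ-d₄ : toℕ d₄ ≡ 1 + i
    toℕ-d₄ = trans (Fin.toℕ-inject₁ _) (Fin.toℕ-fromℕ (1 + i))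

    -- Such a rank lies past those of `c + 2` and `n - 1`, and is shifted once for each of them and
    -- once for 0.
    punchIn-top : ∀ x {v} → toℕ x ≡ v → 2 + i ≤ v →
      toℕ (suc (Fin.punchIn (suc c) (Fin.punchIn b₂ x))) ≡ 3 + v
    punchIn-top x refl v≥ = cong suc (trans
      (toℕ-punchIn-≥ (suc c) _ (subst (suc (toℕ c) ≤_) (sym eq) (ℕ.≤-trans (s≤s c≤) (ℕ.m≤n⇒m≤1+n v≥))))
      (cong suc eq))
      where
      eq : toℕ (Fin.punchIn b₂ x) ≡ suc (toℕ x)
      eq = toℕ-punchIn-≥ b₂ x (subst (_≤ toℕ x) (sym toℕ-b₂) v≥)

  -- The word 0, c + 2, n - 1, 1, n, followed by the other elements in increasing order.
  word : FramedPermutation (5 + i)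
  word .perm = Perm.lift₀ (Perm.insert 0F (suc c) (Perm.insert 0F b₂
    (Perm.insert 0F 0F (Perm.insert 0F d₄ Perm.id))))
  word .leftmost = refl
  word .rightmost = Fin.toℕ-injective (trans
    (punchIn-top (suc (Fin.punchIn d₄ (suc (fromℕ i)))) (cong suc last≡) (ℕ.m≤n+m _ 1))
    (sym (Fin.toℕ-fromℕ (6 + i))))
    where
    last≡ : toℕ (Fin.punchIn d₄ (suc (fromℕ i))) ≡ 2 + i
    last≡ = trans (toℕ-punchIn-≥ d₄ (suc (fromℕ i))
      (ℕ.≤-reflexive (trans toℕ-d₄ (sym (Fin.toℕ-fromℕ (1 + i)))))) (cong (2 +_) (Fin.toℕ-fromℕ i))

  private
    toℕ-b : toℕ (elementAt word 2F) ≡ 4 + i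
    toℕ-b = cong suc (trans
      (toℕ-punchIn-≥ (suc c) b₂ (subst (suc (toℕ c) ≤_) (sym toℕ-b₂) (s≤s c≤))) (cong suc toℕ-b₂))

    toℕ-d : toℕ (elementAt word 4F) ≡ 5 + i
    toℕ-d = punchIn-top (suc d₄) (cong suc toℕ-d₄) ℕ.≤-refl

    1<a : 1 < toℕ (elementAt word 1F)
    1<a = s≤s (s≤s z≤n)

    a<b : elementAt word 1F Fin.< elementAt word 2F
    a<b = subst (2 + toℕ c <_) (sym toℕ-b) (s≤s (s≤s (s≤s c≤)))

    b≤d : elementAt word 2F Fin.≤ elementAt word 4F
    b≤d = subst₂ _≤_ (sym toℕ-b) (sym toℕ-d) (ℕ.m≤n+m _ 1)

  word-sameRanges : k ≤ toℕ c → SameRanges k word (swapFirst word)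
  word-sameRanges k≤c = swapFirst-sameRanges word refl 1<a a<b b≤d (s≤s (s≤s k≤c))

  word-sameSides : 2 + toℕ c + k < 4 + i → SameSides k word (swapFirst word)
  word-sameSides {k} k< = swapFirst-sameSides word refl 1<a a<b b≤d (subst (2 + toℕ c + k <_) (sym toℕ-b) k<)

¬reconstructing : ∀ i {k} → k < 2 + i → ¬ Reconstructing (5 + i) k
¬reconstructing i {k} (s≤s k≤) R = swapFirst-≉ P (R P (swapFirst P)
  (sameRanges⇒profile P (swapFirst P) (word-sameRanges c c≤ (subst (k ≤_) (sym toℕ-c) k≤))))
  where
  1+i<5+i : 1 + i < 5 + i
  1+i<5+i = s≤s (s≤s (ℕ.m≤n+m i 3))
  -- This gives `a = n - 2`, the largest value below `b = n - 1`, which puts the exceptional pairs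
  -- as far apart as possible.
  c : Fin (5 + i)
  c = Fin.fromℕ< 1+i<5+i
  toℕ-c : toℕ c ≡ 1 + i
  toℕ-c = Fin.toℕ-fromℕ< 1+i<5+i
  c≤ : toℕ c ≤ 1 + i
  c≤ = ℕ.≤-reflexive toℕ-c
  P : FramedPermutation (5 + i)
  P = word c c≤

¬directedReconstructing : ∀ i {k} → k + k < 2 + i → ¬ DirectedReconstructing (5 + i) k
¬directedReconstructing i {k} 2k< R = swapFirst-≉ P (R P (swapFirst P) (⇒directedProfile P (swapFirst P)
  (word-sameRanges c c≤ (ℕ.≤-reflexive (sym toℕ-c)))
  (word-sameSides c c≤ (subst (λ v → 2 + v + k < 4 + i) (sym toℕ-c) (s≤s (s≤s 2k<))))))
  where
  k≤1+i : k ≤ 1 + i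
  k≤1+i = ℕ.≤-trans (ℕ.m≤m+n k k) (ℕ.≤-pred 2k<)
  k<5+i : k < 5 + i
  k<5+i = ℕ.≤-trans (s≤s k≤1+i) (ℕ.m≤n+m _ 3)
  -- `a = k + 2` is the least value whose exceptional ranges escape `k`; it leaves the most room for
  -- `a + k < n - 1`, which hides the direction of `(a, b)`.
  c : Fin (5 + i)
  c = Fin.fromℕ< k<5+i
  toℕ-c : toℕ c ≡ k
  toℕ-c = Fin.toℕ-fromℕ< k<5+i
  c≤ : toℕ c ≤ 1 + i
  c≤ = subst (_≤ 1 + i) (sym toℕ-c) k≤1+i
  P : FramedPermutation (5 + i)
  P = word c c≤

-- The two minima

1⊔[n∸3]≤1+n : ∀ n → 1 ⊔ (n ∸ 3) ≤ suc n
1⊔[n∸3]≤1+n n = ℕ.⊔-lub (s≤s z≤n) (ℕ.≤-trans (ℕ.m∸n≤m n 3) (ℕ.n≤1+n n))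

isKᵘ : ∀ n → 1 ≤ n → IsKᵘ n (1 ⊔ (n ∸ 3))
isKᵘ n 1≤n = record
  { positive = ℕ.m≤m⊔n 1 (n ∸ 3)
  ; bounded  = 1⊔[n∸3]≤1+n n
  ; holds    = reconstructing-n∸3 n
  ; minimal  = λ k 1≤k _ Rk → minimal n k 1≤k Rk
  }
  where
  minimal : ∀ n k → 1 ≤ k → Reconstructing n k → 1 ⊔ (n ∸ 3) ≤ k
  minimal 0 k 1≤k _ = 1≤k
  minimal 1 k 1≤k _ = 1≤k
  minimal 2 k 1≤k _ = 1≤k
  minimal 3 k 1≤k _ = 1≤k
  minimal 4 k 1≤k _ = 1≤k
  -- Here `1 ⊔ (n ∸ 3)` computes to `2 + i`.
  minimal (suc (suc (suc (suc (suc i))))) k _ Rk = ℕ.≮⇒≥ λ k< → ¬reconstructing i k< Rk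

isKᵈ : ∀ n → ∃[ k ] IsKᵈ n k
isKᵈ n = least (directedReconstructing? n)
  (directedReconstructing-mono (1⊔[n∸3]≤1+n n) (reconstructing⇒directed (reconstructing-n∸3 n)))

kᵈ-bound : ∀ n k → 4 ≤ n → 1 ≤ k → DirectedReconstructing n k → ⌈ n ∸ 3 /2⌉ ≤ k
kᵈ-bound 4 k _ 1≤k _ = 1≤k
kᵈ-bound (suc (suc (suc (suc (suc i))))) k _ _ Rk with (k + k) ℕ.<? 2 + i
... | yes 2k< = contradiction Rk (¬directedReconstructing i 2k<)
-- The inequality `2 + i ≤ k + k` is halved, rounding up.
... | no 2k≮  = ℕ.≤-trans (ℕ.⌈n/2⌉-mono (ℕ.≮⇒≥ 2k≮)) (ℕ.≤-reflexive (sym (ℕ.n≡⌈n+n/2⌉ k)))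
kᵈ-bound 1 _ (s≤s ()) _ _
kᵈ-bound 2 _ (s≤s (s≤s ())) _ _
kᵈ-bound 3 _ (s≤s (s≤s (s≤s ()))) _ _

theorem2 : (∀ (n : ℕ) → 1 ≤ n → IsKᵘ n (1 ⊔ (n ∸ 3)))
    × (∀ (n : ℕ) → 4 ≤ n → ∃[ k ] (IsKᵈ n k × ⌈ n ∸ 3 /2⌉ ≤ k))
    × (∀ (n : ℕ) → 1 ≤ n → n ≤ 3 → IsKᵈ n 1)
theorem2 = isKᵘ
  , (λ n 4≤n → let k , isK = isKᵈ n in
      k , isK , kᵈ-bound n k 4≤n (IsMinimumIn[1,_].positive isK) (IsMinimumIn[1,_].holds isK))
  , λ n _ n≤3 → record
    { positive = s≤s z≤n
    ; bounded  = s≤s z≤n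
    ; holds    = reconstructing⇒directed (reconstructing-1 n (ℕ.m≤n⇒m≤1+n n≤3))
    ; minimal  = λ _ 1≤k _ _ → 1≤k
    }
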